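{- For every integer $n\ge 1$, $$\tau(n) = \frac{65}{756} \sigma_{11}(n) + \frac{691}{756} \sigma_5(n) - \frac{2\cdot 691}{3n}\sum_{m=1}^{n-1}m\,\sigma_5(m)\sigma_5(n-m).$$
   Context: $\tau(n)$ is Ramanujan's tau function, defined by $q\prod_{n\ge 1}(1-q^n)^{24} = \sum_{n\ge 1}\tau(n)q^n$. For $k\ge 1$, $\sigma_k(n)=\sum_{d\mid n} d^k$ (sum over positive divisors of $n$). For $n=1$ the sum $\sum_{m=1}^{n-1}$ is empty and equals $0$. -}

module Defs where

open import Data.Bool using (if_then_else_)
open import Data.Fin using (Fin; toℕ; fromℕ; inject₁)
open import Data.Fin.Properties using (toℕ-fromℕ; toℕ-inject₁; toℕ<n)
open import Data.Integer using (ℤ; 0ℤ; 1ℤ; _+_; _-_; _*_)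
open import Data.Integer.Properties
  using (+-*-semiring; +-identityˡ; +-identityʳ; *-identityʳ; *-zeroʳ)
open import Data.List using (map; filter; applyUpTo)
open import Data.Nat as ℕ using (ℕ; zero; suc; _∸_; _≤_; _<_; _^_; _≟_)
open import Data.Nat.Divisibility using (_∣?_)
open import Data.Nat.ListAction using (sum)
import Data.Nat.Properties as ℕ
open import Relation.Binary.PropositionalEquality
open import Relation.Nullary using (does)
open import Relation.Nullary.Decidable using (dec-false)

open import Algebra.Properties.Semiring.Sum +-*-semiring
  using (sum-syntax; sum⁺-syntax; sum-cong-≗; sum-init-last; sum-replicate-zero)

-- σ k n = Σ_{d ∣ n} d ^ k, meaningful for n ≥ 1: for n = 0 the range of
-- candidate divisors is empty, so σ k 0 = 0.
σ : ℕ → ℕ → ℕ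
σ k n = sum (map (_^ k) (filter (_∣? n) (applyUpTo suc n)))

-- Formal power series over ℤ, given by their coefficients.
Series : Set
Series = ℕ → ℤ

q^_ : ℕ → Series
(q^ k) n = if does (k ≟ n) then 1ℤ else 0ℤ

1ₛ : Series
1ₛ = q^ 0

infixl 6 _-ₛ_
infixl 7 _*ₛ_
infixr 8 _^ₛ_

_-ₛ_ : Series → Series → Series
(f -ₛ g) n = f n - g n

_*ₛ_ : Series → Series → Series
(f *ₛ g) n = ∑[ i ≤ n ] (f (toℕ i) * g (n ∸ toℕ i))

_^ₛ_ : Series → ℕ → Series
f ^ₛ zero  = 1ₛ
f ^ₛ suc k = (f ^ₛ k) *ₛ f

-- ∏≤ f N = f 1 · f 2 ⋯ f N
∏≤ : (ℕ → Series) → ℕ → Series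
∏≤ f zero    = 1ₛ
∏≤ f (suc N) = ∏≤ f N *ₛ f (suc N)

-- The infinite product f 1 · f 2 ⋯, for factors with f k ≡ 1 modulo q ^ k:
-- the n-th coefficients of the partial products are then constant from the
-- n-th partial product on (∏≤-stable below), and ∏∞ takes that limit.
∏∞ : (ℕ → Series) → Series
∏∞ f n = ∏≤ f n n

τ : ℕ → ℤ
τ = (q^ 1) *ₛ ∏∞ (λ k → (1ₛ -ₛ q^ k) ^ₛ 24)

-- f ≡ 1 modulo q ^ k
_≡1mod-q^_ : Series → ℕ → Set
f ≡1mod-q^ k = ∀ m → m < k → f m ≡ 1ₛ m

*ₛ-≡1 : ∀ f g {k} → g ≡1mod-q^ k → ∀ n → n < k → (f *ₛ g) n ≡ f n
*ₛ-≡1 f g {k} g≡1 n n<k = begin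
  (f *ₛ g) n                                      ≡⟨ sum-init-last term ⟩
  (∑[ i < n ] term (inject₁ i)) + term (fromℕ n)  ≡⟨ cong₂ _+_ init≡0 last≡ ⟩
  0ℤ + f n                                        ≡⟨ +-identityˡ (f n) ⟩
  f n                                             ∎
  where
  open ≡-Reasoning
  term : Fin (suc n) → ℤ
  term i = f (toℕ i) * g (n ∸ toℕ i)

  vanish : ∀ (i : Fin n) → term (inject₁ i) ≡ 0ℤ
  vanish i = begin
    term (inject₁ i)
      ≡⟨ cong (λ j → f j * g (n ∸ j)) (toℕ-inject₁ i) ⟩
    f (toℕ i) * g (n ∸ toℕ i)
      ≡⟨ cong (f (toℕ i) *_) (g≡1 _ (ℕ.≤-<-trans (ℕ.m∸n≤m n (toℕ i)) n<k)) ⟩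
    f (toℕ i) * 1ₛ (n ∸ toℕ i)
      ≡⟨ cong (λ b → f (toℕ i) * (if b then 1ℤ else 0ℤ))
              (dec-false (0 ≟ n ∸ toℕ i) (ℕ.<⇒≢ (ℕ.m<n⇒0<n∸m (toℕ<n i)))) ⟩
    f (toℕ i) * 0ℤ
      ≡⟨ *-zeroʳ (f (toℕ i)) ⟩
    0ℤ ∎

  init≡0 : ∑[ i < n ] term (inject₁ i) ≡ 0ℤ
  init≡0 = trans (sum-cong-≗ vanish) (sum-replicate-zero n)

  last≡ : term (fromℕ n) ≡ f n
  last≡ = begin
    term (fromℕ n)     ≡⟨ cong (λ j → f j * g (n ∸ j)) (toℕ-fromℕ n) ⟩
    f n * g (n ∸ n)    ≡⟨ cong (λ j → f n * g j) (ℕ.n∸n≡0 n) ⟩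
    f n * g 0          ≡⟨ cong (f n *_) (g≡1 0 (ℕ.≤-<-trans ℕ.z≤n n<k)) ⟩
    f n * 1ℤ           ≡⟨ *-identityʳ (f n) ⟩
    f n                ∎

^ₛ-≡1 : ∀ {f k} → f ≡1mod-q^ k → ∀ e → (f ^ₛ e) ≡1mod-q^ k
^ₛ-≡1         f≡1 zero    m m<k = refl
^ₛ-≡1 {f} {k} f≡1 (suc e) m m<k =
  trans (*ₛ-≡1 (f ^ₛ e) f f≡1 m m<k) (^ₛ-≡1 f≡1 e m m<k)

1-q^-≡1 : ∀ k → (1ₛ -ₛ q^ k) ≡1mod-q^ k
1-q^-≡1 k m m<k = trans
  (cong (λ b → 1ₛ m - (if b then 1ℤ else 0ℤ)) (dec-false (k ≟ m) (ℕ.>⇒≢ m<k)))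
  (+-identityʳ (1ₛ m))

∏≤-stable : ∀ f → (∀ k → f k ≡1mod-q^ k) →
            ∀ {n N} → n ≤ N → ∏≤ f N n ≡ ∏∞ f n
∏≤-stable f f≡1 n≤N = go (ℕ.≤⇒≤′ n≤N)
  where
  go : ∀ {n N} → n ℕ.≤′ N → ∏≤ f N n ≡ ∏∞ f n
  go (ℕ.≤′-reflexive refl)      = refl
  go {n} {suc N} (ℕ.≤′-step n≤′N) = trans
    (*ₛ-≡1 (∏≤ f N) (f (suc N)) (f≡1 (suc N)) n (ℕ.s≤s (ℕ.≤′⇒≤ n≤′N)))
    (go n≤′N)

-- The case e = 24 is the product defining τ.
eulerProduct-converges : ∀ e {n N} → n ≤ N →
  ∏≤ (λ k → (1ₛ -ₛ q^ k) ^ₛ e) N n ≡ ∏∞ (λ k → (1ₛ -ₛ q^ k) ^ₛ e) n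
eulerProduct-converges e = ∏≤-stable _ (λ k → ^ₛ-≡1 (1-q^-≡1 k) e)

{-# OPTIONS --safe #-}
-- Write θ = q d/dq, U a = q ^ a / (1 - q ^ a) and s k = ∑ σ k n q ^ n = ∑ a ^ k U a. For a polynomial K such
-- that K(a, b) and K(a, a + b) are both symmetric in a and b, the identity U a U b = U (a + b) (1 + U a + U b)
-- turns ∑ (K(a, a + b) - K(a, b)) U a U b into a combination of divisor sums (Skoruppa's combinatorial proof
-- of Eisenstein series identities). Three choices of K give
--   θ E₆ = (E₂ E₆ - E₈) / 2,   E₆ E₈ = E₁₄,   θ E₁₂ = E₂ E₁₂ - E₁₄,
-- so E₁₂ - E₆² satisfies θ f = E₂ f. By logarithmic differentiation so does Δ = q ∏ (1 - q ^ k) ^ 24, and this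
-- equation determines a series without constant term from its coefficient of q. Finally, the weight m in the
-- sum of the theorem comes from θ (s 5 · s 5) = 2 θ (s 5) · s 5.
module Submission where

open import Algebra.Bundles using (CommutativeRing)
import Algebra.Properties.Group as GroupProperties
import Algebra.Solver.Ring.NaturalCoefficients.Default as SemiringSolver
import Relation.Binary.Reasoning.Setoid as SetoidReasoning

-- The three identities are exactly what makes the derivative close up: θ (E₁₂ - E₆²) = E₂ E₁₂ - E₁₄
-- - E₆ (E₂ E₆ - E₈), and E₁₄ = E₆ E₈ leaves E₂ (E₁₂ - E₆²). The derivatives in the first and third
-- identity come from the diagonal a = b: expanding U a U b produces each pair a < c twice but no
-- pair (c, c), so symmetrising leaves a term K(c, c) (U c)², and θ (U c) = c U c + c (U c)² trades
-- that square for a derivative. The other remainder is the sum of K(a, c) over 1 ≤ a < c,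
-- multiplied by U c; it is a polynomial in c, whence the divisor sums. The obstacle is size:
-- degrees go up to 13 and coefficients into the tens of thousands. So the conditions on K are
-- checked on closed normal forms, and the final elimination is done with letters in place of the
-- coefficients. All of it stays over ℤ, with multiples of the Eisenstein series freed of their
-- constant terms; rational numbers enter only in the last step.

-- Geometric series in a commutative ring.

module GeometricSeries {c ℓ} (R : CommutativeRing c ℓ) where
  open CommutativeRing R
  open GroupProperties +-group using (∙-cancelʳ)
  open SemiringSolver commutativeSemiring using (solve; _:=_; _:+_; _:*_; con)
  open SetoidReasoning setoid

  -- u = x / (1 - x)
  resolvent : ∀ {x u f t} → u ≈ x + x * u → t ≈ f + x * t → t ≈ f + u * f
  resolvent {x} {u} {f} {t} u-eq t-eq = ∙-cancelʳ (u * t) t (f + u * f) (begin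
    -- Since `1 + u` is the inverse of 1 - x, multiplying `t-eq` by it makes the same term `u * t`
    -- appear on both sides.
    t + u * t                           ≈⟨ +-cong t-eq (*-congˡ t-eq) ⟩
    (f + x * t) + u * (f + x * t)       ≈⟨ solve 4 (λ f t u x →
                                             (f :+ x :* t) :+ u :* (f :+ x :* t) :=
                                             (f :+ u :* f) :+ (x :+ x :* u) :* t) refl f t u x ⟩
    (f + u * f) + (x + x * u) * t       ≈⟨ +-congˡ (*-congʳ u-eq) ⟨
    (f + u * f) + u * t                 ∎)

  -- Expanding `u * v` by the two defining equations shows that it solves t = f + x y t with f = x y
  -- (1 + u + v). By `resolvent` the solution is f + w f, and the equation of `w` absorbs the factor
  -- x y.
  product : ∀ {x y u v w} → u ≈ x + x * u → v ≈ y + y * v → w ≈ x * y + x * y * w →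
            u * v ≈ w + w * u + w * v
  product {x} {y} {u} {v} {w} u-eq v-eq w-eq = begin
    u * v                                ≈⟨ resolvent w-eq uv-eq ⟩
    f + w * f                            ≈⟨ solve 5 (λ x y u v w →
                                              let f = x :* y :* (con 1 :+ u :+ v) in
                                              f :+ w :* f := (x :* y :+ x :* y :* w) :* (con 1 :+ u :+ v))
                                              refl x y u v w ⟩
    (x * y + x * y * w) * (1# + u + v)   ≈⟨ *-congʳ w-eq ⟨
    w * (1# + u + v)                     ≈⟨ solve 3 (λ u v w →
                                              w :* (con 1 :+ u :+ v) := w :+ w :* u :+ w :* v) refl u v w ⟩
    w + w * u + w * v                    ∎
    where
    f = x * y * (1# + u + v)
    uv-eq : u * v ≈ f + x * y * (u * v)
    uv-eq = trans (*-cong u-eq v-eq) (solve 4 (λ x y u v →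
      (x :+ x :* u) :* (y :+ y :* v) :=
      x :* y :* (con 1 :+ u :+ v) :+ x :* y :* (u :* v)) refl x y u v)

  -- t is the derivative of u when a * x is the derivative of x.
  derivative : ∀ {a x u t} → u ≈ x + x * u → t ≈ a * x + (a * x * u + x * t) →
               t ≈ a * u + a * (u * u)
  derivative {a} {x} {u} {t} u-eq t-eq = begin
    t                             ≈⟨ resolvent u-eq (trans t-eq (solve 4 (λ a x u t →
                                       a :* x :+ (a :* x :* u :+ x :* t) :=
                                       a :* (x :+ x :* u) :+ x :* t) refl a x u t)) ⟩
    f + u * f                     ≈⟨ +-cong (*-congˡ u-eq) (*-congˡ (*-congˡ u-eq)) ⟨
    a * u + u * (a * u)           ≈⟨ solve 2 (λ a u → a :* u :+ u :* (a :* u) := a :* u :+ a :* (u :* u)) refl a u ⟩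
    a * u + a * (u * u)           ∎
    where
    f = a * (x + x * u)

open import Defs
import Algebra.Construct.Pointwise as Pointwise
open import Data.Bool using (true; false; if_then_else_)
open import Data.Fin using (toℕ)
open import Data.Fin.Patterns using (0F; 1F)
open import Data.Integer using (+_)
open import Data.Integer.Properties
open import Data.List using (List; []; _∷_; map; filter; foldr; applyUpTo)
open import Data.Nat as ℕ using (ℕ; zero; suc; NonZero; _∸_; _≤_; _<_; z≤n; s≤s)
open import Data.Nat.Divisibility using (_∣_; _∣?_; >⇒∤; ∣-refl; ∣m+n∣m⇒∣n; ∣m∣n⇒∣m+n)
open import Data.Nat.ListAction using (sum)
open import Data.Nat.Properties using (m*n≢0)
import Data.Nat.Properties as ℕ
open import Data.Product using (_×_; _,_)
open import Data.Vec using ([]; _∷_)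
open import Function using (_∘_; mk⇔)
open import Level using (0ℓ)
open import Relation.Binary.PropositionalEquality hiding ([_])
open import Relation.Nullary using (does; yes; no)
open import Relation.Nullary.Decidable using (dec-true; dec-false; does-⇔)
open import Relation.Unary using (Decidable)

-- Passage to rational numbers.

module Fractions where
  open import Data.Integer as ℤ using (ℤ; 1ℤ; _+_; _-_; _*_; -_)
  open import Data.Integer.Tactic.RingSolver using (solve-∀)
  open import Data.Rational as ℚ using (toℚᵘ)
  import Data.Rational.Properties as ℚ
  open import Data.Rational.Unnormalised as ℚᵘ using (mkℚᵘ; *≡*; _≃_)
  import Data.Rational.Unnormalised.Properties as ℚᵘ

  module _ (t a x b y c w : ℤ) (d e : ℕ) where
    -- The hypothesis is the conclusion multiplied by both denominators. In unnormalised rationals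
    -- equality is cross multiplication, so reduction to lowest terms does not interfere.
    /-sum : t * + suc d * + suc e ≡ (a * x + b * y) * + suc e - c * w * + suc d →
            t ℚ./ 1 ≡ (a ℚ./ suc d) ℚ.* (x ℚ./ 1) ℚ.+ (b ℚ./ suc d) ℚ.* (y ℚ./ 1) ℚ.- (c ℚ./ suc e) ℚ.* (w ℚ./ 1)
    /-sum eq = ℚ.toℚᵘ-injective (begin
      toℚᵘ (t ℚ./ 1)
        ≈⟨ ℚ.toℚᵘ-fromℚᵘ (mkℚᵘ t 0) ⟩
      mkℚᵘ t 0
        ≈⟨ *≡* cross ⟩
      mkℚᵘ a d ℚᵘ.* mkℚᵘ x 0 ℚᵘ.+ mkℚᵘ b d ℚᵘ.* mkℚᵘ y 0 ℚᵘ.- mkℚᵘ c e ℚᵘ.* mkℚᵘ w 0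
        ≈⟨ ℚᵘ.+-cong (ℚᵘ.+-cong (product a d x) (product b d y)) (ℚᵘ.-‿cong (product c e w)) ⟨
      toℚᵘ (a/d ℚ.* x/1) ℚᵘ.+ toℚᵘ (b/d ℚ.* y/1) ℚᵘ.- toℚᵘ (c/e ℚ.* w/1)
        ≈⟨ ℚᵘ.+-cong (ℚ.toℚᵘ-homo-+ (a/d ℚ.* x/1) (b/d ℚ.* y/1)) (ℚ.toℚᵘ-homo‿- (c/e ℚ.* w/1)) ⟨
      toℚᵘ (a/d ℚ.* x/1 ℚ.+ b/d ℚ.* y/1) ℚᵘ.+ toℚᵘ (ℚ.- (c/e ℚ.* w/1))
        ≈⟨ ℚ.toℚᵘ-homo-+ (a/d ℚ.* x/1 ℚ.+ b/d ℚ.* y/1) (ℚ.- (c/e ℚ.* w/1)) ⟨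
      toℚᵘ (a/d ℚ.* x/1 ℚ.+ b/d ℚ.* y/1 ℚ.- c/e ℚ.* w/1) ∎)
      where
      open ℚᵘ.≃-Reasoning
      a/d = a ℚ./ suc d
      b/d = b ℚ./ suc d
      c/e = c ℚ./ suc e
      x/1 = x ℚ./ 1
      y/1 = y ℚ./ 1
      w/1 = w ℚ./ 1
      product : ∀ p d q → toℚᵘ ((p ℚ./ suc d) ℚ.* (q ℚ./ 1)) ≃ mkℚᵘ p d ℚᵘ.* mkℚᵘ q 0
      product p d q = ℚᵘ.≃-trans (ℚ.toℚᵘ-homo-* (p ℚ./ suc d) (q ℚ./ 1))
        (ℚᵘ.*-cong (ℚ.toℚᵘ-fromℚᵘ (mkℚᵘ p d)) (ℚ.toℚᵘ-fromℚᵘ (mkℚᵘ q 0)))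
      δ = + suc d
      ε = + suc e
      identity : ∀ (t a x b y c w δ ε : ℤ) → t * δ * ε ≡ (a * x + b * y) * ε - c * w * δ →
        t * ((δ * 1ℤ * (δ * 1ℤ)) * (ε * 1ℤ)) ≡
        (((a * x) * (δ * 1ℤ) + (b * y) * (δ * 1ℤ)) * (ε * 1ℤ) + (- (c * w)) * (δ * 1ℤ * (δ * 1ℤ))) * 1ℤ
      identity t a x b y c w δ ε eq = trans (left t δ ε)
        (trans (cong (λ z → δ * z) eq) (right (a * x) (b * y) (c * w) δ ε))
        where
        left : ∀ (t δ ε : ℤ) → t * ((δ * 1ℤ * (δ * 1ℤ)) * (ε * 1ℤ)) ≡ δ * (t * δ * ε)
        left = solve-∀
        right : ∀ (p q r δ ε : ℤ) → δ * ((p + q) * ε + - (r * δ)) ≡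
          ((p * (δ * 1ℤ) + q * (δ * 1ℤ)) * (ε * 1ℤ) + (- r) * (δ * 1ℤ * (δ * 1ℤ))) * 1ℤ
        right = solve-∀
      cross : t * ((δ * 1ℤ * (δ * 1ℤ)) * (ε * 1ℤ)) ≡
              (((a * x) * (δ * 1ℤ) + (b * y) * (δ * 1ℤ)) * (ε * 1ℤ) + (- (c * w)) * (δ * 1ℤ * (δ * 1ℤ))) * 1ℤ
      cross = identity t a x b y c w δ ε eq

module Eisenstein where
  open import Algebra.Properties.Semiring.Sum +-*-semiring
    using (sum-syntax; ∑-distrib-+; ∑-comm; *-distribˡ-sum; sum-replicate-zero)
  open import Data.Integer as ℤ using (ℤ; 0ℤ; 1ℤ; _+_; _-_; _*_; -_)
  open import Data.Integer.Solver using (module +-*-Solver)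
  open import Data.Integer.Tactic.RingSolver using (solve-∀)
  import Data.Rational as ℚ
  open +-*-Solver
    using (Polynomial; op; con; var; _:^_; :-_; _:+_; _:*_; _:-_; [+]; [*]; ⟦_⟧; ⟦_⟧N; normalise; correct)
  open ≡-Reasoning

  -- The ring of formal power series over ℤ.

  infixl 6 _+ₛ_
  infixr 7 _·ₛ_

  _+ₛ_ : Series → Series → Series
  (f +ₛ g) n = f n + g n

  _·ₛ_ : ℤ → Series → Series
  (c ·ₛ f) n = c * f n

  cong-+ : ∀ (i : ℤ) {j k} → j ≡ k → i + j ≡ i + k
  cong-+ i = cong (λ x → i + x)

  -- This bounded form lets infinite sums and products be replaced by truncations that are correct
  -- only up to the coefficient in question.
  *ₛ-cong-≤ : ∀ {f f′ g g′} n → (∀ m → m ≤ n → f m ≡ f′ m) → (∀ m → m ≤ n → g m ≡ g′ m) →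
              (f *ₛ g) n ≡ (f′ *ₛ g′) n
  *ₛ-cong-≤ zero    p q = cong (_+ 0ℤ) (cong₂ _*_ (p 0 z≤n) (q 0 z≤n))
  *ₛ-cong-≤ (suc n) p q = cong₂ _+_ (cong₂ _*_ (p 0 z≤n) (q (suc n) ℕ.≤-refl))
    (*ₛ-cong-≤ n (λ m m≤n → p (suc m) (s≤s m≤n)) (λ m m≤n → q m (ℕ.m≤n⇒m≤1+n m≤n)))

  *ₛ-cong : ∀ {f f′ g g′} → f ≗ f′ → g ≗ g′ → f *ₛ g ≗ f′ *ₛ g′
  *ₛ-cong p q n = *ₛ-cong-≤ n (λ m _ → p m) (λ m _ → q m)

  *ₛ-distribʳ : ∀ h f g → (f +ₛ g) *ₛ h ≗ f *ₛ h +ₛ g *ₛ h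
  *ₛ-distribʳ h f g zero    = rearrange (f 0) (g 0) (h 0)
    where
    rearrange : ∀ (x y z : ℤ) → (x + y) * z + 0ℤ ≡ (x * z + 0ℤ) + (y * z + 0ℤ)
    rearrange = solve-∀
  *ₛ-distribʳ h f g (suc n) = trans
    (cong-+ ((f 0 + g 0) * h (suc n)) (*ₛ-distribʳ h (f ∘ suc) (g ∘ suc) n))
    (rearrange (f 0) (g 0) (h (suc n)) (((f ∘ suc) *ₛ h) n) (((g ∘ suc) *ₛ h) n))
    where
    rearrange : ∀ (x y z u v : ℤ) → (x + y) * z + (u + v) ≡ (x * z + u) + (y * z + v)
    rearrange = solve-∀

  ·ₛ-*ₛ : ∀ c f g → (c ·ₛ f) *ₛ g ≗ c ·ₛ (f *ₛ g)
  ·ₛ-*ₛ c f g zero    = rearrange c (f 0) (g 0)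
    where
    rearrange : ∀ (c x y : ℤ) → c * x * y + 0ℤ ≡ c * (x * y + 0ℤ)
    rearrange = solve-∀
  ·ₛ-*ₛ c f g (suc n) = trans (cong-+ (c * f 0 * g (suc n)) (·ₛ-*ₛ c (f ∘ suc) g n))
    (rearrange c (f 0) (g (suc n)) (((f ∘ suc) *ₛ g) n))
    where
    rearrange : ∀ (c x y u : ℤ) → c * x * y + c * u ≡ c * (x * y + u)
    rearrange = solve-∀

  -- A product unfolds by itself at the constant term of the left factor. Splitting off the constant
  -- term of the right factor is the mirror image, needed for commutativity and for the recursion
  -- behind `solution-unique`.
  *ₛ-suc′ : ∀ f g n → (f *ₛ g) (suc n) ≡ (f *ₛ (g ∘ suc)) n + f (suc n) * g 0
  *ₛ-suc′ f g zero    = rearrange (f 0 * g 1) (f 1 * g 0)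
    where
    rearrange : ∀ (x y : ℤ) → x + (y + 0ℤ) ≡ x + 0ℤ + y
    rearrange = solve-∀
  *ₛ-suc′ f g (suc n) = trans (cong-+ (f 0 * g (suc (suc n))) (*ₛ-suc′ (f ∘ suc) g n))
    (sym (+-assoc (f 0 * g (suc (suc n))) (((f ∘ suc) *ₛ (g ∘ suc)) n) (f (suc (suc n)) * g 0)))

  *ₛ-comm : ∀ f g → f *ₛ g ≗ g *ₛ f
  *ₛ-comm f g zero    = cong (_+ 0ℤ) (*-comm (f 0) (g 0))
  *ₛ-comm f g (suc n) = begin
    f 0 * g (suc n) + ((f ∘ suc) *ₛ g) n  ≡⟨ +-comm (f 0 * g (suc n)) _ ⟩
    ((f ∘ suc) *ₛ g) n + f 0 * g (suc n)  ≡⟨ cong₂ _+_ (*ₛ-comm (f ∘ suc) g n) (*-comm (f 0) (g (suc n))) ⟩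
    (g *ₛ (f ∘ suc)) n + g (suc n) * f 0  ≡⟨ *ₛ-suc′ g f n ⟨
    (g *ₛ f) (suc n)                      ∎

  *ₛ-assoc : ∀ f g h → (f *ₛ g) *ₛ h ≗ f *ₛ (g *ₛ h)
  *ₛ-assoc f g h zero    = rearrange (f 0) (g 0) (h 0)
    where
    rearrange : ∀ (x y z : ℤ) → (x * y + 0ℤ) * z + 0ℤ ≡ x * (y * z + 0ℤ) + 0ℤ
    rearrange = solve-∀
  *ₛ-assoc f g h (suc n) = begin
    (f 0 * g 0 + 0ℤ) * h (suc n) + ((f *ₛ g) ∘ suc *ₛ h) n
      ≡⟨ cong₂ _+_ (cong (_* h (suc n)) (+-identityʳ (f 0 * g 0))) (begin
         ((f *ₛ g) ∘ suc *ₛ h) n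
           ≡⟨ *ₛ-distribʳ h (f 0 ·ₛ (g ∘ suc)) ((f ∘ suc) *ₛ g) n ⟩
         ((f 0 ·ₛ (g ∘ suc)) *ₛ h) n + (((f ∘ suc) *ₛ g) *ₛ h) n
           ≡⟨ cong₂ _+_ (·ₛ-*ₛ (f 0) (g ∘ suc) h n) (*ₛ-assoc (f ∘ suc) g h n) ⟩
         f 0 * ((g ∘ suc) *ₛ h) n + ((f ∘ suc) *ₛ (g *ₛ h)) n ∎) ⟩
    f 0 * g 0 * h (suc n) + (f 0 * ((g ∘ suc) *ₛ h) n + ((f ∘ suc) *ₛ (g *ₛ h)) n)
      ≡⟨ rearrange (f 0) (g 0) (h (suc n)) _ _ ⟩
    f 0 * (g 0 * h (suc n) + ((g ∘ suc) *ₛ h) n) + ((f ∘ suc) *ₛ (g *ₛ h)) n ∎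
    where
    rearrange : ∀ (x y z u v : ℤ) → x * y * z + (x * u + v) ≡ x * (y * z + u) + v
    rearrange = solve-∀

  *ₛ-distribˡ : ∀ f g h → f *ₛ (g +ₛ h) ≗ f *ₛ g +ₛ f *ₛ h
  *ₛ-distribˡ f g h n = begin
    (f *ₛ (g +ₛ h)) n          ≡⟨ *ₛ-comm f (g +ₛ h) n ⟩
    ((g +ₛ h) *ₛ f) n          ≡⟨ *ₛ-distribʳ f g h n ⟩
    (g *ₛ f) n + (h *ₛ f) n    ≡⟨ cong₂ _+_ (*ₛ-comm g f n) (*ₛ-comm h f n) ⟩
    (f *ₛ g) n + (f *ₛ h) n    ∎

  q^-*ₛ-suc : ∀ k f n → (q^ suc k *ₛ f) (suc n) ≡ (q^ k *ₛ f) n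
  q^-*ₛ-suc k f n = +-identityˡ _

  q^-*ₛ : ∀ k f m → (q^ k *ₛ f) (k ℕ.+ m) ≡ f m
  q^-*ₛ zero    f zero    = trans (+-identityʳ (1ℤ * f 0)) (*-identityˡ (f 0))
  q^-*ₛ zero    f (suc m) = begin
    1ℤ * f (suc m) + ((λ _ → 0ℤ) *ₛ f) m      ≡⟨ cong₂ _+_ (*-identityˡ (f (suc m))) (·ₛ-*ₛ 0ℤ (λ _ → 0ℤ) f m) ⟩
    f (suc m) + 0ℤ * ((λ _ → 0ℤ) *ₛ f) m      ≡⟨⟩
    f (suc m) + 0ℤ                            ≡⟨ +-identityʳ (f (suc m)) ⟩
    f (suc m)                                 ∎
  q^-*ₛ (suc k) f m       = trans (q^-*ₛ-suc k f (k ℕ.+ m)) (q^-*ₛ k f m)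

  q^-*ₛ-< : ∀ k f n → n < k → (q^ k *ₛ f) n ≡ 0ℤ
  q^-*ₛ-< (suc k) f zero    _         = refl
  q^-*ₛ-< (suc k) f (suc n) (s≤s n<k) = trans (q^-*ₛ-suc k f n) (q^-*ₛ-< k f n n<k)

  seriesRing : CommutativeRing 0ℓ 0ℓ
  seriesRing = record
    { Carrier = Series
    ; _≈_     = _≗_
    ; _+_     = _+ₛ_
    ; _*_     = _*ₛ_
    ; -_      = λ f n → - f n
    ; 0#      = λ _ → 0ℤ
    ; 1#      = 1ₛ
    ; isCommutativeRing = record
      { isRing = record
        { +-isAbelianGroup = Pointwise.isAbelianGroup ℕ +-0-isAbelianGroup
        ; *-cong     = *ₛ-cong
        ; *-assoc    = *ₛ-assoc
        ; *-identity = q^-*ₛ 0 , λ f n → trans (*ₛ-comm f 1ₛ n) (q^-*ₛ 0 f n)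
        ; distrib    = *ₛ-distribˡ , *ₛ-distribʳ
        }
      ; *-comm = *ₛ-comm
      }
    }

  -- The derivation θ.

  -- θ = q d/dq
  θ : Series → Series
  θ f n = + n * f n

  θ-*ₛ : ∀ f g → θ (f *ₛ g) ≗ θ f *ₛ g +ₛ f *ₛ θ g
  θ-*ₛ f g zero    = rearrange (f 0) (g 0)
    where
    rearrange : ∀ (x y : ℤ) → 0ℤ * (x * y + 0ℤ) ≡ (0ℤ * x * y + 0ℤ) + (x * (0ℤ * y) + 0ℤ)
    rearrange = solve-∀
  θ-*ₛ f g (suc n) = begin
    (1ℤ + + n) * (f 0 * g (suc n) + (f′ *ₛ g) n)
      ≡⟨ rearrange (+ n) (f 0) (g (suc n)) ((f′ *ₛ g) n) ⟩
    f 0 * ((1ℤ + + n) * g (suc n)) + (f′ *ₛ g) n + + n * (f′ *ₛ g) n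
      ≡⟨ cong-+ (f 0 * ((1ℤ + + n) * g (suc n)) + (f′ *ₛ g) n) (θ-*ₛ f′ g n) ⟩
    f 0 * ((1ℤ + + n) * g (suc n)) + (f′ *ₛ g) n + ((θ f′ *ₛ g) n + (f′ *ₛ θ g) n)
      ≡⟨ rearrange′ (f 0) ((1ℤ + + n) * g (suc n)) (g (suc n)) ((f′ *ₛ g) n) ((θ f′ *ₛ g) n) ((f′ *ₛ θ g) n) ⟩
    (0ℤ * f 0 * g (suc n) + ((f′ *ₛ g) n + (θ f′ *ₛ g) n)) + (f 0 * ((1ℤ + + n) * g (suc n)) + (f′ *ₛ θ g) n)
      ≡⟨ cong (λ x → (0ℤ * f 0 * g (suc n) + x) + (θ g *′ n)) (*ₛ-distribʳ g f′ (θ f′) n) ⟨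
    (0ℤ * f 0 * g (suc n) + ((f′ +ₛ θ f′) *ₛ g) n) + (θ g *′ n)
      ≡⟨ cong (λ x → (0ℤ * f 0 * g (suc n) + x) + (θ g *′ n)) (*ₛ-cong {g = g} tail-θ (λ _ → refl) n) ⟩
    (θ f *ₛ g) (suc n) + (f *ₛ θ g) (suc n) ∎
    where
    f′ = f ∘ suc
    _*′_ : Series → ℕ → ℤ
    h *′ n = f 0 * h (suc n) + (f′ *ₛ h) n
    -- θ does not commute with the shift: the index grows by one, which contributes the extra
    -- summand `f′`.
    tail-θ : f′ +ₛ θ f′ ≗ θ f ∘ suc
    tail-θ m = sym (suc-* (+ m) (f (suc m)))
    rearrange : ∀ (n x y u : ℤ) → (1ℤ + n) * (x * y + u) ≡ x * ((1ℤ + n) * y) + u + n * u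
    rearrange = solve-∀
    rearrange′ : ∀ (x y z u v w : ℤ) → x * y + u + (v + w) ≡ (0ℤ * x * z + (u + v)) + (x * y + w)
    rearrange′ = solve-∀

  -- Lambert series and their geometric terms.

  -- q ^ a / (1 - q ^ a)
  geo : ℕ → Series
  geo a zero    = 0ℤ
  geo a (suc m) = if does (a ∣? suc m) then 1ℤ else 0ℤ

  geo-< : ∀ a n → n < a → geo a n ≡ 0ℤ
  geo-< a zero    _   = refl
  geo-< a (suc n) n<a = cong (if_then 1ℤ else 0ℤ) (dec-false (a ∣? suc n) (>⇒∤ n<a))

  q^-+ : ∀ k m → (q^ k) (k ℕ.+ m) ≡ 1ₛ m
  q^-+ zero    m = refl
  q^-+ (suc k) m = q^-+ k m

  q^-≢ : ∀ {k n} → k ≢ n → (q^ k) n ≡ 0ℤ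
  q^-≢ {k} {n} k≢n = cong (if_then 1ℤ else 0ℤ) (dec-false (k ℕ.≟ n) k≢n)

  q^-+-*ₛ : ∀ a b → q^ (a ℕ.+ b) ≗ q^ a *ₛ q^ b
  q^-+-*ₛ zero    b n       = sym (q^-*ₛ 0 (q^ b) n)
  q^-+-*ₛ (suc a) b zero    = refl
  q^-+-*ₛ (suc a) b (suc n) = trans (q^-+-*ₛ a b n) (sym (q^-*ₛ-suc a (q^ b) n))

  θ-q^ : ∀ a → θ (q^ a) ≗ + a ·ₛ q^ a
  θ-q^ a n with a ℕ.≟ n
  ... | yes refl = refl
  ... | no  a≢n  = begin
    + n * (q^ a) n  ≡⟨ cong (λ x → + n * x) (q^-≢ a≢n) ⟩
    + n * 0ℤ        ≡⟨ *-zeroʳ (+ n) ⟩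
    0ℤ              ≡⟨ *-zeroʳ (+ a) ⟨
    + a * 0ℤ        ≡⟨ cong (λ x → + a * x) (q^-≢ a≢n) ⟨
    + a * (q^ a) n  ∎

  -- Below a everything vanishes; at a + m it is the fact that a divides a + m exactly when it
  -- divides m. The case m = 0 is special: `geo a` has no constant term although a divides 0, and q
  -- ^ a supplies the missing 1.
  geo-unfold : ∀ k → let a = suc k in geo a ≗ q^ a +ₛ q^ a *ₛ geo a
  geo-unfold k n with n ℕ.<? suc k
  ... | yes n<a = trans (geo-< (suc k) n n<a)
                    (sym (cong₂ _+_ (q^-≢ (ℕ.>⇒≢ n<a)) (q^-*ₛ-< (suc k) (geo (suc k)) n n<a)))
  ... | no  n≮a with ℕ.m≤n⇒∃[o]m+o≡n (ℕ.≮⇒≥ n≮a)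
  ... | m , refl = trans (shifted m)
                     (sym (cong₂ _+_ (q^-+ (suc k) m) (q^-*ₛ (suc k) (geo (suc k)) m)))
    where
    a = suc k
    shifted : ∀ m → geo a (a ℕ.+ m) ≡ 1ₛ m + geo a m
    shifted zero    = cong (if_then 1ℤ else 0ℤ)
      (dec-true (a ∣? (a ℕ.+ 0)) (subst (a ∣_) (sym (ℕ.+-identityʳ a)) ∣-refl))
    shifted (suc m) = trans
      (cong (if_then 1ℤ else 0ℤ) (does-⇔ (mk⇔ (λ a∣a+m → ∣m+n∣m⇒∣n a∣a+m ∣-refl) (∣m∣n⇒∣m+n ∣-refl))
        (a ∣? (a ℕ.+ suc m)) (a ∣? suc m)))
      (sym (+-identityˡ (geo a (suc m))))

  geo-*ₛ : ∀ i j → let a = suc i ; b = suc j in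
           geo a *ₛ geo b ≗ geo (a ℕ.+ b) +ₛ geo (a ℕ.+ b) *ₛ geo a +ₛ geo (a ℕ.+ b) *ₛ geo b
  geo-*ₛ i j = GeometricSeries.product seriesRing {q^ a} {q^ b} {geo a} {geo b} {geo (a ℕ.+ b)}
    (geo-unfold i) (geo-unfold j) w-eq
    where
    a = suc i
    b = suc j
    w-eq : geo (a ℕ.+ b) ≗ q^ a *ₛ q^ b +ₛ q^ a *ₛ q^ b *ₛ geo (a ℕ.+ b)
    w-eq n = trans (geo-unfold (i ℕ.+ b) n)
      (cong₂ _+_ (q^-+-*ₛ a b n) (*ₛ-cong {g = geo (a ℕ.+ b)} (q^-+-*ₛ a b) (λ _ → refl) n))

  ·ₛ-1ₛ-*ₛ : ∀ c f → (c ·ₛ 1ₛ) *ₛ f ≗ c ·ₛ f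
  ·ₛ-1ₛ-*ₛ c f n = trans (·ₛ-*ₛ c 1ₛ f n) (cong (λ x → c * x) (q^-*ₛ 0 f n))

  θ-geo : ∀ i → let a = suc i in θ (geo a) ≗ + a ·ₛ geo a +ₛ + a ·ₛ (geo a *ₛ geo a)
  θ-geo i n = trans
    (GeometricSeries.derivative seriesRing {a = c} {x = x} {u = u} {t = θ u} (geo-unfold i) t-eq n)
    (cong₂ _+_ (·ₛ-1ₛ-*ₛ (+ a) u n) (·ₛ-1ₛ-*ₛ (+ a) (u *ₛ u) n))
    where
    a = suc i
    x = q^ a
    u = geo a
    c = + a ·ₛ 1ₛ
    θx : θ x ≗ c *ₛ x
    θx m = trans (θ-q^ a m) (sym (·ₛ-1ₛ-*ₛ (+ a) x m))
    t-eq : θ u ≗ c *ₛ x +ₛ (c *ₛ x *ₛ u +ₛ x *ₛ θ u)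
    t-eq m = begin
      + m * u m                                ≡⟨ cong (λ y → + m * y) (geo-unfold i m) ⟩
      + m * (x m + (x *ₛ u) m)                 ≡⟨ *-distribˡ-+ (+ m) (x m) ((x *ₛ u) m) ⟩
      θ x m + θ (x *ₛ u) m                     ≡⟨ cong₂ _+_ (θx m) (trans (θ-*ₛ x u m)
                                                    (cong (λ y → y + (x *ₛ θ u) m)
                                                      (*ₛ-cong {g = u} θx (λ _ → refl) m))) ⟩
      (c *ₛ x) m + ((c *ₛ x *ₛ u) m + (x *ₛ θ u) m) ∎

  -- Finite sums and divisor series.

  sum< : ℕ → (ℕ → ℤ) → ℤ
  sum< n f = ∑[ i < n ] f (toℕ i)

  sum<-cong : ∀ n {f g} → (∀ i → i < n → f i ≡ g i) → sum< n f ≡ sum< n g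
  sum<-cong zero    f≡g = refl
  sum<-cong (suc n) f≡g = cong₂ _+_ (f≡g 0 (s≤s z≤n)) (sum<-cong n (λ i i<n → f≡g (suc i) (s≤s i<n)))

  sum<-+ : ∀ n f g → sum< n (λ i → f i + g i) ≡ sum< n f + sum< n g
  sum<-+ n f g = ∑-distrib-+ {n} (f ∘ toℕ) (g ∘ toℕ)

  sum<-* : ∀ n c f → sum< n (λ i → c * f i) ≡ c * sum< n f
  sum<-* n c f = sym (*-distribˡ-sum {n} c (f ∘ toℕ))

  sum<-comm : ∀ m n (f : ℕ → ℕ → ℤ) → sum< m (λ i → sum< n (λ j → f i j)) ≡ sum< n (λ j → sum< m (λ i → f i j))
  sum<-comm m n f = ∑-comm {m} {n} (λ i j → f (toℕ i) (toℕ j))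

  sum<-extend : ∀ f {n N} → n ≤ N → (∀ i → n ≤ i → f i ≡ 0ℤ) → sum< N f ≡ sum< n f
  sum<-extend f {N = N} z≤n       f≡0 = trans (sum<-cong N (λ i _ → f≡0 i z≤n)) (sum-replicate-zero N)
  sum<-extend f         (s≤s n≤N) f≡0 = cong-+ (f 0) (sum<-extend (f ∘ suc) n≤N (λ i n≤i → f≡0 (suc i) (s≤s n≤i)))

  sum-filter-applyUpTo : ∀ {p} {P : ℕ → Set p} (P? : Decidable P) (f g : ℕ → ℕ) n →
    + sum (map f (filter P? (applyUpTo g n))) ≡
    sum< n (λ i → + f (g i) * (if does (P? (g i)) then 1ℤ else 0ℤ))
  sum-filter-applyUpTo P? f g zero    = refl
  sum-filter-applyUpTo P? f g (suc n) with does (P? (g 0))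
  ... | true  = trans (pos-+ (f (g 0)) _)
                  (cong₂ _+_ (sym (*-identityʳ (+ f (g 0)))) (sum-filter-applyUpTo P? f (g ∘ suc) n))
  ... | false = trans (sum-filter-applyUpTo P? f (g ∘ suc) n)
                  (sym (trans (cong (λ x → x + rest) (*-zeroʳ (+ f (g 0)))) (+-identityˡ rest)))
    where
    rest : ℤ
    rest = sum< n (λ i → + f (g (suc i)) * (if does (P? (g (suc i))) then 1ℤ else 0ℤ))

  pos-^ : ∀ m k → + (m ℕ.^ k) ≡ (+ m) ℤ.^ k
  pos-^ m zero    = refl
  pos-^ m (suc k) = trans (pos-* m (m ℕ.^ k)) (cong (λ x → + m * x) (pos-^ m k))

  s : ℕ → Series
  s k n = + σ k n

  -- Divisors of n are at most n, so any larger bound gives the same sum. The freedom in `N`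
  -- provides one bound for all coefficients that enter a product.
  s-geo : ∀ k {n N} → n ≤ N → s k n ≡ sum< N (λ i → (+ suc i) ℤ.^ k * geo (suc i) n)
  s-geo k {n} {N} n≤N = trans (bounded n) (sym (sum<-extend term n≤N vanish))
    where
    term : ℕ → ℤ
    term i = (+ suc i) ℤ.^ k * geo (suc i) n
    vanish : ∀ i → n ≤ i → term i ≡ 0ℤ
    vanish i n≤i = trans (cong (λ x → (+ suc i) ℤ.^ k * x) (geo-< (suc i) n (s≤s n≤i)))
                         (*-zeroʳ ((+ suc i) ℤ.^ k))
    bounded : ∀ n → s k n ≡ sum< n (λ i → (+ suc i) ℤ.^ k * geo (suc i) n)
    bounded zero    = refl
    bounded (suc n) = trans
      (sum-filter-applyUpTo (_∣? suc n) (ℕ._^ k) suc (suc n))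
      (sum<-cong (suc n) (λ i _ → cong (λ x → x * geo (suc i) (suc n)) (pos-^ (suc i) k)))

  sum<-*ₛ : ∀ N (F : ℕ → Series) g → (λ m → sum< N (λ i → F i m)) *ₛ g ≗ λ n → sum< N (λ i → (F i *ₛ g) n)
  sum<-*ₛ zero    F g n = ·ₛ-*ₛ 0ℤ (λ _ → 0ℤ) g n
  sum<-*ₛ (suc N) F g n = trans
    (*ₛ-distribʳ g (F 0) (λ m → sum< N (λ i → F (suc i) m)) n)
    (cong-+ ((F 0 *ₛ g) n) (sum<-*ₛ N (F ∘ suc) g n))

  *ₛ-sum< : ∀ N f (G : ℕ → Series) → f *ₛ (λ m → sum< N (λ i → G i m)) ≗ λ n → sum< N (λ i → (f *ₛ G i) n)
  *ₛ-sum< N f G n = begin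
    (f *ₛ (λ m → sum< N (λ i → G i m))) n  ≡⟨ *ₛ-comm f (λ m → sum< N (λ i → G i m)) n ⟩
    ((λ m → sum< N (λ i → G i m)) *ₛ f) n  ≡⟨ sum<-*ₛ N G f n ⟩
    sum< N (λ i → (G i *ₛ f) n)            ≡⟨ sum<-cong N (λ i _ → *ₛ-comm (G i) f n) ⟩
    sum< N (λ i → (f *ₛ G i) n)            ∎

  *ₛ-·ₛ : ∀ c f g → f *ₛ (c ·ₛ g) ≗ c ·ₛ (f *ₛ g)
  *ₛ-·ₛ c f g n = begin
    (f *ₛ (c ·ₛ g)) n   ≡⟨ *ₛ-comm f (c ·ₛ g) n ⟩
    ((c ·ₛ g) *ₛ f) n   ≡⟨ ·ₛ-*ₛ c g f n ⟩
    c * (g *ₛ f) n      ≡⟨ cong (λ x → c * x) (*ₛ-comm g f n) ⟩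
    c * (f *ₛ g) n      ∎

  -- Double sums and their rearrangement.

  -- The coefficient of q ^ n in ∑ h(a, b) q ^ (a + b) / ((1 - q ^ a) (1 - q ^ b)), summed over a, b ≥ 1.
  T : (ℤ → ℤ → ℤ) → ℕ → ℤ
  T h n = sum< n (λ i → sum< n (λ j → h (+ suc i) (+ suc j) * (geo (suc i) *ₛ geo (suc j)) n))

  T-monomial : ∀ k l n → T (λ a b → a ℤ.^ k * b ℤ.^ l) n ≡ (s k *ₛ s l) n
  T-monomial k l n = sym (begin
    (s k *ₛ s l) n
      ≡⟨ *ₛ-cong-≤ n (λ m m≤n → s-geo k m≤n) (λ m m≤n → s-geo l m≤n) ⟩
    ((λ m → sum< n (λ i → F k i m)) *ₛ S) n
      ≡⟨ sum<-*ₛ n (F k) S n ⟩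
    sum< n (λ i → (F k i *ₛ S) n)
      ≡⟨ sum<-cong n (λ i _ → *ₛ-sum< n (F k i) (F l) n) ⟩
    sum< n (λ i → sum< n (λ j → (F k i *ₛ F l j) n))
      ≡⟨ sum<-cong n (λ i _ → sum<-cong n (λ j _ → pull i j)) ⟩
    T (λ a b → a ℤ.^ k * b ℤ.^ l) n ∎)
    where
    F : ℕ → ℕ → Series
    F k i = ((+ suc i) ℤ.^ k) ·ₛ geo (suc i)
    S : Series
    S m = sum< n (λ j → F l j m)
    pull : ∀ i j → (F k i *ₛ F l j) n ≡ (+ suc i) ℤ.^ k * (+ suc j) ℤ.^ l * (geo (suc i) *ₛ geo (suc j)) n
    pull i j = begin
      (F k i *ₛ F l j) n      ≡⟨ ·ₛ-*ₛ x u (F l j) n ⟩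
      x * (u *ₛ F l j) n      ≡⟨ cong (λ z → x * z) (*ₛ-·ₛ y u v n) ⟩
      x * (y * (u *ₛ v) n)    ≡⟨ *-assoc x y ((u *ₛ v) n) ⟨
      x * y * (u *ₛ v) n      ∎
      where
      x = (+ suc i) ℤ.^ k
      y = (+ suc j) ℤ.^ l
      u = geo (suc i)
      v = geo (suc j)

  T-cong : ∀ {h h′} n → (∀ a b → h a b ≡ h′ a b) → T h n ≡ T h′ n
  T-cong n h≡h′ = sum<-cong n (λ i _ → sum<-cong n (λ j _ →
    cong (λ x → x * (geo (suc i) *ₛ geo (suc j)) n) (h≡h′ (+ suc i) (+ suc j))))

  T-+ : ∀ h h′ n → T (λ a b → h a b + h′ a b) n ≡ T h n + T h′ n
  T-+ h h′ n = begin
    sum< n (λ i → sum< n (λ j → (h (+ suc i) (+ suc j) + h′ (+ suc i) (+ suc j)) * u i j))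
      ≡⟨ sum<-cong n (λ i _ → trans
           (sum<-cong n (λ j _ → *-distribʳ-+ (u i j) (h (+ suc i) (+ suc j)) (h′ (+ suc i) (+ suc j))))
           (sum<-+ n (λ j → h (+ suc i) (+ suc j) * u i j) (λ j → h′ (+ suc i) (+ suc j) * u i j))) ⟩
    sum< n (λ i → sum< n (λ j → h (+ suc i) (+ suc j) * u i j) + sum< n (λ j → h′ (+ suc i) (+ suc j) * u i j))
      ≡⟨ sum<-+ n (λ i → sum< n (λ j → h (+ suc i) (+ suc j) * u i j))
                  (λ i → sum< n (λ j → h′ (+ suc i) (+ suc j) * u i j)) ⟩
    T h n + T h′ n ∎
    where
    u : ℕ → ℕ → ℤ
    u i j = (geo (suc i) *ₛ geo (suc j)) n

  T-* : ∀ c h n → T (λ a b → c * h a b) n ≡ c * T h n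
  T-* c h n = begin
    sum< n (λ i → sum< n (λ j → c * h (+ suc i) (+ suc j) * u i j))
      ≡⟨ sum<-cong n (λ i _ → trans
           (sum<-cong n (λ j _ → *-assoc c (h (+ suc i) (+ suc j)) (u i j)))
           (sum<-* n c (λ j → h (+ suc i) (+ suc j) * u i j))) ⟩
    sum< n (λ i → c * sum< n (λ j → h (+ suc i) (+ suc j) * u i j))
      ≡⟨ sum<-* n c (λ i → sum< n (λ j → h (+ suc i) (+ suc j) * u i j)) ⟩
    c * T h n ∎
    where
    u : ℕ → ℕ → ℤ
    u i j = (geo (suc i) *ₛ geo (suc j)) n

  -- With m = i + j + 1 the pairs (i, j) become the pairs i < m. The inner bound `J` is kept apart
  -- because it stays fixed while `n` drops in the induction; the vanishing of `ψ` from `n` on makes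
  -- the excess harmless.
  sum<-triangle : ∀ {n J} (ψ : ℕ → ℕ → ℤ) → n ≤ J → (∀ i m → n ≤ m → ψ i m ≡ 0ℤ) →
    sum< n (λ i → sum< J (λ j → ψ i (i ℕ.+ suc j))) ≡ sum< n (λ m → sum< m (λ i → ψ i m))
  sum<-triangle {zero}          ψ n≤J ψ≡0 = refl
  sum<-triangle {suc n} {J} ψ n<J ψ≡0 = begin
    sum< J (λ j → ψ 0 (suc j)) + sum< n (λ i → sum< J (λ j → ψ (suc i) (suc (i ℕ.+ suc j))))
      ≡⟨ cong₂ _+_
           (sum<-extend (ψ 0 ∘ suc) n≤J (λ m n≤m → ψ≡0 0 (suc m) (s≤s n≤m)))
           (sum<-triangle (λ i m → ψ (suc i) (suc m)) n≤J (λ i m n≤m → ψ≡0 (suc i) (suc m) (s≤s n≤m))) ⟩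
    sum< n (λ m → ψ 0 (suc m)) + sum< n (λ m → sum< m (λ i → ψ (suc i) (suc m)))
      ≡⟨ sum<-+ n (λ m → ψ 0 (suc m)) (λ m → sum< m (λ i → ψ (suc i) (suc m))) ⟨
    sum< n (λ m → sum< (suc m) (λ i → ψ i (suc m)))
      ≡⟨ +-identityˡ (sum< n (λ m → sum< (suc m) (λ i → ψ i (suc m)))) ⟨
    sum< (suc n) (λ m → sum< m (λ i → ψ i m)) ∎
    where
    n≤J = ℕ.<⇒≤ n<J

  sum<-symmetric : ∀ n (g : ℕ → ℕ → ℤ) → (∀ i j → g i j ≡ g j i) →
    sum< n (λ i → sum< n (λ j → g i j)) ≡ + 2 * sum< n (λ m → sum< m (λ i → g i m)) + sum< n (λ m → g m m)
  sum<-symmetric zero    g g-sym = refl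
  sum<-symmetric (suc n) g g-sym = begin
    g 0 0 + row + sum< n (λ i → g (suc i) 0 + sum< n (λ j → g⁺ i j))
      ≡⟨ cong-+ (g 0 0 + row) (sum<-+ n (λ i → g (suc i) 0) (λ i → sum< n (λ j → g⁺ i j))) ⟩
    g 0 0 + row + (sum< n (λ i → g (suc i) 0) + sum< n (λ i → sum< n (λ j → g⁺ i j)))
      ≡⟨ cong-+ (g 0 0 + row) (cong₂ _+_
           (sum<-cong n (λ i _ → g-sym (suc i) 0))
           (sum<-symmetric n g⁺ (λ i j → g-sym (suc i) (suc j)))) ⟩
    g 0 0 + row + (row + (+ 2 * upper + diagonal))
      ≡⟨ rearrange (g 0 0) row upper diagonal ⟩
    + 2 * (0ℤ + (row + upper)) + (g 0 0 + diagonal)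
      ≡⟨ cong (λ x → + 2 * (0ℤ + x) + (g 0 0 + diagonal))
           (sum<-+ n (λ m → g 0 (suc m)) (λ m → sum< m (λ i → g⁺ i m))) ⟨
    + 2 * sum< (suc n) (λ m → sum< m (λ i → g i m)) + sum< (suc n) (λ m → g m m) ∎
    where
    g⁺ : ℕ → ℕ → ℤ
    g⁺ i j = g (suc i) (suc j)
    row upper diagonal : ℤ
    row      = sum< n (λ j → g 0 (suc j))
    upper    = sum< n (λ m → sum< m (λ i → g⁺ i m))
    diagonal = sum< n (λ m → g⁺ m m)
    rearrange : ∀ (x r u d : ℤ) → x + r + (r + (+ 2 * u + d)) ≡ + 2 * (0ℤ + (r + u)) + (x + d)
    rearrange = solve-∀

  module _ (K : ℤ → ℤ → ℤ)
           (K-sym : ∀ a b → K a b ≡ K b a)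
           (K-invariant : ∀ a b → K a (a + b) ≡ K b (a + b)) where

    -- Apply U a U b = U (a + b) (1 + U a + U b) and put m = a + b. The summand 1 gives X, a sum
    -- over i < m. The other two both give Y: `K-invariant` allows a and b to be exchanged in the
    -- second of them. By symmetry of K, twice the triangle Y plus the diagonal is the full square
    -- `T K`.
    T-relation : ∀ n → T (λ a b → K a (a + b)) n + sum< n (λ m → K (+ suc m) (+ suc m) * (geo (suc m) *ₛ geo (suc m)) n) ≡
      sum< n (λ m → sum< m (λ i → K (+ suc i) (+ suc m)) * geo (suc m) n) + T K n
    T-relation n = begin
      T (λ a b → K a (a + b)) n + diagonal
        ≡⟨ cong (λ x → x + diagonal) split ⟩
      X + (Y + Y) + diagonal
        ≡⟨ rearrange X Y diagonal ⟩
      X + (+ 2 * Y + diagonal)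
        ≡⟨ cong₂ _+_ X-triangle (sym (trans
             (sum<-cong n (λ i _ → sum<-cong n (λ j _ → cong (λ x → K (+ suc i) (+ suc j) * x) (*ₛ-comm (U i) (U j) n))))
             (trans (sum<-symmetric n ψ₂ ψ₂-sym) (cong (λ y → + 2 * y + diagonal) (sym Y-triangle))))) ⟩
      sum< n (λ m → sum< m (λ i → K (+ suc i) (+ suc m)) * U m n) + T K n ∎
      where
      U : ℕ → Series
      U m = geo (suc m)
      ψ₁ ψ₂ : ℕ → ℕ → ℤ
      ψ₁ i m = K (+ suc i) (+ suc m) * U m n
      ψ₂ i m = K (+ suc i) (+ suc m) * (U m *ₛ U i) n
      X Y diagonal : ℤ
      X = sum< n (λ i → sum< n (λ j → ψ₁ i (i ℕ.+ suc j)))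
      Y = sum< n (λ i → sum< n (λ j → ψ₂ i (i ℕ.+ suc j)))
      diagonal = sum< n (λ m → ψ₂ m m)
      rearrange : ∀ (x y d : ℤ) → x + (y + y) + d ≡ x + (+ 2 * y + d)
      rearrange = solve-∀
      ψ₂-sym : ∀ i j → ψ₂ i j ≡ ψ₂ j i
      ψ₂-sym i j = cong₂ _*_ (K-sym (+ suc i) (+ suc j)) (*ₛ-comm (U j) (U i) n)
      ψ₁-vanish : ∀ i m → n ≤ m → ψ₁ i m ≡ 0ℤ
      ψ₁-vanish i m n≤m = trans (cong (λ x → K (+ suc i) (+ suc m) * x) (geo-< (suc m) n (s≤s n≤m)))
                                (*-zeroʳ (K (+ suc i) (+ suc m)))
      ψ₂-vanish : ∀ i m → n ≤ m → ψ₂ i m ≡ 0ℤ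
      ψ₂-vanish i m n≤m = trans
        (cong (λ x → K (+ suc i) (+ suc m) * x)
          (trans (*ₛ-cong-≤ {g′ = U i} n (λ l l≤n → geo-< (suc m) l (s≤s (ℕ.≤-trans l≤n n≤m))) (λ _ _ → refl))
                 (·ₛ-*ₛ 0ℤ (λ _ → 0ℤ) (U i) n)))
        (*-zeroʳ (K (+ suc i) (+ suc m)))
      X-triangle : X ≡ sum< n (λ m → sum< m (λ i → K (+ suc i) (+ suc m)) * U m n)
      X-triangle = trans (sum<-triangle ψ₁ ℕ.≤-refl ψ₁-vanish)
        (sum<-cong n (λ m _ → trans
          (sum<-cong m (λ i _ → *-comm (K (+ suc i) (+ suc m)) (U m n)))
          (trans (sum<-* m (U m n) (λ i → K (+ suc i) (+ suc m))) (*-comm (U m n) _))))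
      Y-triangle : Y ≡ sum< n (λ m → sum< m (λ i → ψ₂ i m))
      Y-triangle = sum<-triangle ψ₂ ℕ.≤-refl ψ₂-vanish
      split-term : ∀ i j → K (+ suc i) (+ suc i + + suc j) * (U i *ₛ U j) n ≡
                           ψ₁ i (i ℕ.+ suc j) + (ψ₂ i (i ℕ.+ suc j) + ψ₂ j (j ℕ.+ suc i))
      split-term i j = begin
        k * (U i *ₛ U j) n
          ≡⟨ cong (λ x → k * x) (geo-*ₛ i j n) ⟩
        k * (W n + (W *ₛ U i) n + (W *ₛ U j) n)
          ≡⟨ expand k (W n) ((W *ₛ U i) n) ((W *ₛ U j) n) ⟩
        k * W n + (k * (W *ₛ U i) n + k * (W *ₛ U j) n)
          ≡⟨ cong (λ x → k * W n + (k * (W *ₛ U i) n + x * (W *ₛ U j) n)) (K-invariant (+ suc i) (+ suc j)) ⟩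
        k * W n + (k * (W *ₛ U i) n + K (+ suc j) (+ suc (i ℕ.+ suc j)) * (W *ₛ U j) n)
          ≡⟨ cong (λ m → k * W n + (k * (W *ₛ U i) n + ψ₂ j m)) i+j≡j+i ⟩
        ψ₁ i (i ℕ.+ suc j) + (ψ₂ i (i ℕ.+ suc j) + ψ₂ j (j ℕ.+ suc i)) ∎
        where
        k = K (+ suc i) (+ suc i + + suc j)
        W = U (i ℕ.+ suc j)
        i+j≡j+i : i ℕ.+ suc j ≡ j ℕ.+ suc i
        i+j≡j+i = trans (ℕ.+-suc i j) (trans (cong suc (ℕ.+-comm i j)) (sym (ℕ.+-suc j i)))
        expand : ∀ (k w x y : ℤ) → k * (w + x + y) ≡ k * w + (k * x + k * y)
        expand = solve-∀
      split : T (λ a b → K a (a + b)) n ≡ X + (Y + Y)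
      split = begin
        T (λ a b → K a (a + b)) n
          ≡⟨ sum<-cong n (λ i _ → trans (sum<-cong n (λ j _ → split-term i j))
               (trans (sum<-+ n (λ j → ψ₁ i (i ℕ.+ suc j)) (λ j → ψ₂ i (i ℕ.+ suc j) + ψ₂ j (j ℕ.+ suc i)))
                      (cong-+ (x i) (sum<-+ n (λ j → ψ₂ i (i ℕ.+ suc j)) (λ j → ψ₂ j (j ℕ.+ suc i)))))) ⟩
        sum< n (λ i → x i + (y i + z i))
          ≡⟨ trans (sum<-+ n x (λ i → y i + z i)) (cong-+ X (sum<-+ n y z)) ⟩
        X + (Y + sum< n z)
          ≡⟨ cong (λ z → X + (Y + z)) (sum<-comm n n (λ i j → ψ₂ j (j ℕ.+ suc i))) ⟩
        X + (Y + Y) ∎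
        where
        x y z : ℕ → ℤ
        x i = sum< n (λ j → ψ₁ i (i ℕ.+ suc j))
        y i = sum< n (λ j → ψ₂ i (i ℕ.+ suc j))
        z i = sum< n (λ j → ψ₂ j (j ℕ.+ suc i))

  -- Polynomial identities by normal forms.

  -- Equality of closed normal forms is checked by evaluation, whereas comparing the values at variables, as the
  -- solver does, unfolds integer products and is infeasible in the degrees needed.
  infix 4 _∼_
  _∼_ : ∀ {n} → Polynomial n → Polynomial n → Set
  p ∼ p′ = normalise p ≡ normalise p′

  ∼⇒≡ : ∀ {n} (p p′ : Polynomial n) → p ∼ p′ → ∀ ρ → ⟦ p ⟧ ρ ≡ ⟦ p′ ⟧ ρ
  ∼⇒≡ p p′ p∼p′ ρ = trans (sym (correct p ρ)) (trans (cong (λ x → ⟦ x ⟧N ρ) p∼p′) (correct p′ ρ))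

  ⟦:^⟧ : ∀ {n} (p : Polynomial n) k ρ → ⟦ p :^ k ⟧ ρ ≡ ⟦ p ⟧ ρ ℤ.^ k
  ⟦:^⟧ p zero    ρ = refl
  ⟦:^⟧ p (suc k) ρ = cong (λ x → ⟦ p ⟧ ρ * x) (⟦:^⟧ p k ρ)

  infix 10 _[_∥_]
  -- Substitution acts on the syntax, so that K(a, a + b) is again a closed expression with a
  -- computable normal form.
  _[_∥_] : ∀ {n} → Polynomial 2 → Polynomial n → Polynomial n → Polynomial n
  op o p p′ [ x ∥ y ] = op o (p [ x ∥ y ]) (p′ [ x ∥ y ])
  con c     [ x ∥ y ] = con c
  var 0F    [ x ∥ y ] = x
  var 1F    [ x ∥ y ] = y
  (p :^ k)  [ x ∥ y ] = p [ x ∥ y ] :^ k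
  (:- p)    [ x ∥ y ] = :- (p [ x ∥ y ])

  ⟦[∥]⟧ : ∀ {n} p (x y : Polynomial n) ρ → ⟦ p [ x ∥ y ] ⟧ ρ ≡ ⟦ p ⟧ (⟦ x ⟧ ρ ∷ ⟦ y ⟧ ρ ∷ [])
  ⟦[∥]⟧ (op [+] p p′) x y ρ = cong₂ _+_ (⟦[∥]⟧ p x y ρ) (⟦[∥]⟧ p′ x y ρ)
  ⟦[∥]⟧ (op [*] p p′) x y ρ = cong₂ _*_ (⟦[∥]⟧ p x y ρ) (⟦[∥]⟧ p′ x y ρ)
  ⟦[∥]⟧ (con c)       x y ρ = refl
  ⟦[∥]⟧ (var 0F)      x y ρ = refl
  ⟦[∥]⟧ (var 1F)      x y ρ = refl
  ⟦[∥]⟧ (p :^ zero)   x y ρ = refl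
  ⟦[∥]⟧ (p :^ suc k)  x y ρ = cong₂ _*_ (⟦[∥]⟧ p x y ρ) (⟦[∥]⟧ (p :^ k) x y ρ)
  ⟦[∥]⟧ (:- p)        x y ρ = cong -_ (⟦[∥]⟧ p x y ρ)

  -- The three polynomials and their certificates.

  polynomial : List (ℤ × ℕ × ℕ) → Polynomial 2
  polynomial = foldr (λ { (c , i , j) p → con c :* var 0F :^ i :* var 1F :^ j :+ p }) (con 0ℤ)

  -- Up to sign E and D are e₂ and e₃², for e₂ and e₃ the elementary symmetric functions of a, - c and c - a;
  -- they generate the polynomials of even degree with the symmetries required in a certificate.
  A C E D : Polynomial 2
  A = var 0F
  C = var 1F
  E = A :* A :- A :* C :+ C :* C
  D = (A :* C :* (A :- C)) :^ 2

  -- `E` and `D` take at (a, a + b) their values at (- a, b), so K(a, a + b) - K(a, b) is minus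
  -- twice the part of K odd in a. In degree 6 the combination `K₁` kills a³b³ and leaves a b⁵ + a⁵
  -- b. In degree 12 `K₂` has only a⁵b⁷ + a⁷b⁵ as odd part, while `K₃` kills these and a³b⁹ + a⁹b³,
  -- leaving a b¹¹ + a¹¹ b.
  K₁ K₂ K₃ : Polynomial 2
  K₁ = con (+ 2) :* E :^ 3 :- con (+ 7) :* D
  K₂ = D :^ 2
  K₃ = con (+ 2) :* E :^ 6 :- con (+ 20) :* (E :^ 3 :* D) :+ con (+ 47) :* D :^ 2

  G₁ G₂ G₃ : Polynomial 2
  G₁ = polynomial
     ((+ 12 , 7 , 0) ∷ (- + 42 , 6 , 1) ∷ (- + 42 , 6 , 0) ∷ (+ 42 , 5 , 2) ∷ (+ 126 , 5 , 1) ∷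
      (+ 42 , 5 , 0) ∷ (- + 105 , 4 , 2) ∷ (- + 105 , 4 , 1) ∷ (+ 70 , 3 , 4) ∷ (+ 70 , 3 , 2) ∷
      (- + 14 , 3 , 0) ∷ (- + 126 , 2 , 5) ∷ (- + 105 , 2 , 4) ∷ (+ 21 , 2 , 1) ∷ (+ 84 , 1 , 6) ∷
      (+ 126 , 1 , 5) ∷ (+ 35 , 1 , 4) ∷ (- + 7 , 1 , 2) ∷ (+ 2 , 1 , 0) ∷ [])

  G₂ = polynomial
     ((+ 140 , 9 , 4) ∷ (- + 630 , 8 , 5) ∷ (- + 630 , 8 , 4) ∷ (+ 1080 , 7 , 6) ∷ (+ 2520 , 7 , 5) ∷
      (+ 840 , 7 , 4) ∷ (- + 840 , 6 , 7) ∷ (- + 3780 , 6 , 6) ∷ (- + 2940 , 6 , 5) ∷ (+ 252 , 5 , 8) ∷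
      (+ 2520 , 5 , 7) ∷ (+ 3780 , 5 , 6) ∷ (- + 588 , 5 , 4) ∷ (- + 630 , 4 , 8) ∷
      (- + 2100 , 4 , 7) ∷ (+ 1470 , 4 , 5) ∷ (+ 420 , 3 , 8) ∷ (- + 1260 , 3 , 6) ∷ (+ 280 , 3 , 4) ∷
      (+ 420 , 2 , 7) ∷ (- + 420 , 2 , 5) ∷ (- + 42 , 1 , 8) ∷ (+ 180 , 1 , 6) ∷ (- + 42 , 1 , 4) ∷ [])

  G₃ = polynomial
     ((+ 420 , 13 , 0) ∷ (- + 2730 , 12 , 1) ∷ (- + 2730 , 12 , 0) ∷ (+ 5460 , 11 , 2) ∷
      (+ 16380 , 11 , 1) ∷ (+ 5460 , 11 , 0) ∷ (- + 30030 , 10 , 2) ∷ (- + 30030 , 10 , 1) ∷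
      (- + 10010 , 9 , 4) ∷ (+ 50050 , 9 , 2) ∷ (- + 10010 , 9 , 0) ∷ (+ 45045 , 8 , 4) ∷
      (+ 45045 , 8 , 1) ∷ (+ 17160 , 7 , 6) ∷ (- + 60060 , 7 , 4) ∷ (- + 60060 , 7 , 2) ∷
      (+ 17160 , 7 , 0) ∷ (- + 60060 , 6 , 6) ∷ (- + 60060 , 6 , 1) ∷ (- + 18018 , 5 , 8) ∷
      (+ 60060 , 5 , 6) ∷ (+ 42042 , 5 , 4) ∷ (+ 60060 , 5 , 2) ∷ (- + 18018 , 5 , 0) ∷
      (+ 45045 , 4 , 8) ∷ (+ 45045 , 4 , 1) ∷ (+ 20020 , 3 , 10) ∷ (- + 30030 , 3 , 8) ∷
      (- + 20020 , 3 , 6) ∷ (- + 20020 , 3 , 4) ∷ (- + 30030 , 3 , 2) ∷ (+ 9100 , 3 , 0) ∷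
      (- + 16380 , 2 , 11) ∷ (- + 30030 , 2 , 10) ∷ (- + 13650 , 2 , 1) ∷ (+ 5460 , 1 , 12) ∷
      (+ 16380 , 1 , 11) ∷ (+ 10010 , 1 , 10) ∷ (+ 3003 , 1 , 8) ∷ (+ 2860 , 1 , 6) ∷
      (+ 3003 , 1 , 4) ∷ (+ 4550 , 1 , 2) ∷ (- + 1382 , 1 , 0) ∷ [])

  -- G is M times the antidifference of K in the first variable, obtained from Faulhaber's formulas;
  -- M clears its denominators.
  record Certificate : Set where
    field
      K G : Polynomial 2
      M κ k β₁ β₂ β₃ : ℤ
      i j w e₁ e₂ e₃ : ℕ
      symmetric  : K ∼ K [ C ∥ A ]
      invariant  : K [ A ∥ A :+ C ] ∼ K [ C ∥ A :+ C ]
      odd        : con M :* K [ A ∥ A :+ C ] ∼ con M :* K :+ con κ :* (A :^ i :* C :^ j :+ A :^ j :* C :^ i)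
      diagonal   : con M :* K [ A ∥ A ] ∼ con k :* A :^ w :* A
      difference : G [ con 1ℤ :+ A ∥ C ] ∼ G :+ con M :* K
      total      : G [ A ∥ A ] :- G [ con 1ℤ ∥ A ] :+ con k :* A :^ w :* A ∼
                   con β₁ :* A :^ e₁ :+ con β₂ :* A :^ e₂ :+ con β₃ :* A :^ e₃

  -- With E₂ = 1 - 24 s 1, E₆ = 1 - 504 s 5, E₈ = 1 + 480 s 7, E₁₂ = 1 + (65520 / 691) s 11 and E₁₄
  -- = 1 - 24 s 13, the resulting relations are the three Eisenstein identities multiplied by - 1 /
  -- 6, 1 / 12 and 691 / 12, up to moving terms across.
  certificate₁ certificate₂ certificate₃ : Certificate
  certificate₁ = record
    { K = K₁ ; G = G₁ ; M = + 42 ; κ = + 504 ; k = + 84 ; i = 1 ; j = 5 ; w = 5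
    ; β₁ = + 2 ; e₁ = 1 ; β₂ = + 42 ; e₂ = 5 ; β₃ = + 40 ; e₃ = 7
    ; symmetric = refl ; invariant = refl ; odd = refl ; diagonal = refl ; difference = refl ; total = refl }
  certificate₂ = record
    -- `K₂` vanishes on the diagonal, hence `k` is 0; `w = 11` makes the zero term the one written
    -- in `convolution₂`.
    { K = K₂ ; G = G₂ ; M = + 1260 ; κ = + 10080 ; k = + 0 ; i = 5 ; j = 7 ; w = 11
    ; β₁ = - + 42 ; e₁ = 5 ; β₂ = + 40 ; e₂ = 7 ; β₃ = + 2 ; e₃ = 13
    ; symmetric = refl ; invariant = refl ; odd = refl ; diagonal = refl ; difference = refl ; total = refl }
  certificate₃ = record
    { K = K₃ ; G = G₃ ; M = + 2730 ; κ = + 65520 ; k = + 5460 ; i = 1 ; j = 11 ; w = 11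
    ; β₁ = - + 1382 ; e₁ = 1 ; β₂ = + 5460 ; e₂ = 11 ; β₃ = + 1382 ; e₃ = 13
    ; symmetric = refl ; invariant = refl ; odd = refl ; diagonal = refl ; difference = refl ; total = refl }

  -- From a certificate to a convolution identity.

  sum<-telescope : ∀ m (g : ℕ → ℤ) → sum< m (λ i → g (suc i) - g i) ≡ g m - g 0
  sum<-telescope zero    g = sym (+-inverseʳ (g 0))
  sum<-telescope (suc m) g = trans (cong-+ (g 1 - g 0) (sum<-telescope m (g ∘ suc)))
                                   (collapse (g 0) (g 1) (g (suc m)))
    where
    collapse : ∀ (x y z : ℤ) → y + - x + (z + - y) ≡ z + - x
    collapse = solve-∀

  sum<-*-geo : ∀ c k n → sum< n (λ m → c * (+ suc m) ℤ.^ k * geo (suc m) n) ≡ c * s k n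
  sum<-*-geo c k n = begin
    sum< n (λ m → c * (+ suc m) ℤ.^ k * geo (suc m) n)
      ≡⟨ sum<-cong n (λ m _ → *-assoc c ((+ suc m) ℤ.^ k) (geo (suc m) n)) ⟩
    sum< n (λ m → c * ((+ suc m) ℤ.^ k * geo (suc m) n))
      ≡⟨ sum<-* n c (λ m → (+ suc m) ℤ.^ k * geo (suc m) n) ⟩
    c * sum< n (λ m → (+ suc m) ℤ.^ k * geo (suc m) n)
      ≡⟨ cong (λ x → c * x) (s-geo k {n} ℕ.≤-refl) ⟨
    c * s k n ∎

  module _ (certificate : Certificate) where
    open Certificate certificate

    private
      eval : Polynomial 2 → ℤ → ℤ → ℤ
      eval p a c = ⟦ p ⟧ (a ∷ c ∷ [])

      U : ℕ → Series
      U m = geo (suc m)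

      monomial : ∀ (p : Polynomial 2) l ρ x → ⟦ p ⟧ ρ ≡ x → ⟦ p :^ l ⟧ ρ ≡ x ℤ.^ l
      monomial p l ρ x p≡x = trans (⟦:^⟧ p l ρ) (cong (ℤ._^ l) p≡x)

      K-symmetric : ∀ a b → eval K a b ≡ eval K b a
      K-symmetric a b = trans (∼⇒≡ K (K [ C ∥ A ]) symmetric ρ) (⟦[∥]⟧ K C A ρ)
        where ρ = a ∷ b ∷ []

      K-invariant : ∀ a b → eval K a (a + b) ≡ eval K b (a + b)
      K-invariant a b = begin
        eval K a (a + b)              ≡⟨ ⟦[∥]⟧ K A (A :+ C) ρ ⟨
        ⟦ K [ A ∥ A :+ C ] ⟧ ρ        ≡⟨ ∼⇒≡ (K [ A ∥ A :+ C ]) (K [ C ∥ A :+ C ]) invariant ρ ⟩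
        ⟦ K [ C ∥ A :+ C ] ⟧ ρ        ≡⟨ ⟦[∥]⟧ K C (A :+ C) ρ ⟩
        eval K b (a + b)              ∎
        where
        ρ = a ∷ b ∷ []

      K-odd : ∀ a b → M * eval K a (a + b) ≡
                      M * eval K a b + κ * (a ℤ.^ i * b ℤ.^ j + a ℤ.^ j * b ℤ.^ i)
      K-odd a b = begin
        M * eval K a (a + b)
          ≡⟨ cong (λ x → M * x) (⟦[∥]⟧ K A (A :+ C) ρ) ⟨
        ⟦ con M :* K [ A ∥ A :+ C ] ⟧ ρ
          ≡⟨ ∼⇒≡ (con M :* K [ A ∥ A :+ C ])
                 (con M :* K :+ con κ :* (A :^ i :* C :^ j :+ A :^ j :* C :^ i)) odd ρ ⟩
        ⟦ con M :* K :+ con κ :* (A :^ i :* C :^ j :+ A :^ j :* C :^ i) ⟧ ρ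
          ≡⟨ cong (λ x → M * eval K a b + κ * x)
               (cong₂ _+_ (cong₂ _*_ (⟦:^⟧ A i ρ) (⟦:^⟧ C j ρ)) (cong₂ _*_ (⟦:^⟧ A j ρ) (⟦:^⟧ C i ρ))) ⟩
        M * eval K a b + κ * (a ℤ.^ i * b ℤ.^ j + a ℤ.^ j * b ℤ.^ i) ∎
        where
        ρ = a ∷ b ∷ []

      K-diagonal : ∀ c → M * eval K c c ≡ k * c ℤ.^ w * c
      K-diagonal c = begin
        M * eval K c c               ≡⟨ cong (λ x → M * x) (⟦[∥]⟧ K A A ρ) ⟨
        ⟦ con M :* K [ A ∥ A ] ⟧ ρ   ≡⟨ ∼⇒≡ (con M :* K [ A ∥ A ]) (con k :* A :^ w :* A) diagonal ρ ⟩
        ⟦ con k :* A :^ w :* A ⟧ ρ   ≡⟨ cong (λ x → k * x * c) (⟦:^⟧ A w ρ) ⟩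
        k * c ℤ.^ w * c              ∎
        where
        ρ = c ∷ c ∷ []

      G-difference : ∀ a c → M * eval K a c ≡ eval G (1ℤ + a) c - eval G a c
      G-difference a c = begin
        M * eval K a c
          ≡⟨ cancel (eval G a c) (M * eval K a c) ⟩
        ⟦ G :+ con M :* K ⟧ ρ - eval G a c
          ≡⟨ cong (λ x → x - eval G a c) (∼⇒≡ (G [ con 1ℤ :+ A ∥ C ]) (G :+ con M :* K) difference ρ) ⟨
        ⟦ G [ con 1ℤ :+ A ∥ C ] ⟧ ρ - eval G a c
          ≡⟨ cong (λ x → x - eval G a c) (⟦[∥]⟧ G (con 1ℤ :+ A) C ρ) ⟩
        eval G (1ℤ + a) c - eval G a c ∎
        where
        ρ = a ∷ c ∷ []
        cancel : ∀ (x y : ℤ) → y ≡ x + y + - x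
        cancel = solve-∀

      G-total : ∀ c → eval G c c - eval G 1ℤ c + k * c ℤ.^ w * c ≡
                      β₁ * c ℤ.^ e₁ + β₂ * c ℤ.^ e₂ + β₃ * c ℤ.^ e₃
      G-total c = begin
        eval G c c - eval G 1ℤ c + k * c ℤ.^ w * c
          ≡⟨ cong₂ _+_ (cong₂ _-_ (⟦[∥]⟧ G A A ρ) (⟦[∥]⟧ G (con 1ℤ) A ρ)) (cong (λ x → k * x * c) (⟦:^⟧ A w ρ)) ⟨
        ⟦ G [ A ∥ A ] :- G [ con 1ℤ ∥ A ] :+ con k :* A :^ w :* A ⟧ ρ
          ≡⟨ ∼⇒≡ (G [ A ∥ A ] :- G [ con 1ℤ ∥ A ] :+ con k :* A :^ w :* A)
                 (con β₁ :* A :^ e₁ :+ con β₂ :* A :^ e₂ :+ con β₃ :* A :^ e₃) total ρ ⟩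
        ⟦ con β₁ :* A :^ e₁ :+ con β₂ :* A :^ e₂ :+ con β₃ :* A :^ e₃ ⟧ ρ
          ≡⟨ cong₂ _+_ (cong₂ (λ x y → β₁ * x + β₂ * y) (⟦:^⟧ A e₁ ρ) (⟦:^⟧ A e₂ ρ))
                       (cong (λ x → β₃ * x) (⟦:^⟧ A e₃ ρ)) ⟩
        β₁ * c ℤ.^ e₁ + β₂ * c ℤ.^ e₂ + β₃ * c ℤ.^ e₃ ∎
        where
        ρ = c ∷ c ∷ []

      row-sum : ∀ m → M * sum< m (λ i → eval K (+ suc i) (+ suc m)) ≡
                      eval G (+ suc m) (+ suc m) - eval G 1ℤ (+ suc m)
      row-sum m = begin
        M * sum< m (λ i → eval K (+ suc i) (+ suc m))
          ≡⟨ sum<-* m M (λ i → eval K (+ suc i) (+ suc m)) ⟨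
        sum< m (λ i → M * eval K (+ suc i) (+ suc m))
          ≡⟨ sum<-cong m (λ i _ → G-difference (+ suc i) (+ suc m)) ⟩
        sum< m (λ i → eval G (+ suc (suc i)) (+ suc m) - eval G (+ suc i) (+ suc m))
          ≡⟨ sum<-telescope m (λ i → eval G (+ suc i) (+ suc m)) ⟩
        eval G (+ suc m) (+ suc m) - eval G 1ℤ (+ suc m) ∎

    module _ (n : ℕ) where
      private
        -- The row over 1 ≤ a < c telescopes to G(c, c) - G(1, c). The added k c^(w + 1) is the
        -- linear term that `diagonal-term` leaves behind; together they form the polynomial of
        -- `total`.
        total-term : ∀ m → let c = + suc m in
          M * (sum< m (λ i → eval K (+ suc i) c) * U m n) + k * c ℤ.^ w * c * U m n ≡
          β₁ * c ℤ.^ e₁ * U m n + (β₂ * c ℤ.^ e₂ * U m n + β₃ * c ℤ.^ e₃ * U m n)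
        total-term m = begin
          M * (row * u) + d * u
            ≡⟨ collect M row u d ⟩
          (M * row + d) * u
            ≡⟨ cong (λ x → x * u) (trans (cong (λ x → x + d) (row-sum m)) (G-total c)) ⟩
          (β₁ * c ℤ.^ e₁ + β₂ * c ℤ.^ e₂ + β₃ * c ℤ.^ e₃) * u
            ≡⟨ distribute (β₁ * c ℤ.^ e₁) (β₂ * c ℤ.^ e₂) (β₃ * c ℤ.^ e₃) u ⟩
          β₁ * c ℤ.^ e₁ * u + (β₂ * c ℤ.^ e₂ * u + β₃ * c ℤ.^ e₃ * u) ∎
          where
          c = + suc m
          u = U m n
          d = k * c ℤ.^ w * c
          row = sum< m (λ i → eval K (+ suc i) c)
          collect : ∀ (M r u d : ℤ) → M * (r * u) + d * u ≡ (M * r + d) * u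
          collect = solve-∀
          distribute : ∀ (x y z u : ℤ) → (x + y + z) * u ≡ x * u + (y * u + z * u)
          distribute = solve-∀

        -- `θ-geo` completes c (U c)² by c U c to θ (U c); this is where the term with the
        -- derivative of `s w` originates.
        diagonal-term : ∀ m → let c = + suc m in
          M * (eval K c c * (U m *ₛ U m) n) + k * c ℤ.^ w * c * U m n ≡ + n * (k * c ℤ.^ w * U m n)
        diagonal-term m = begin
          M * (eval K c c * uu) + k * c ℤ.^ w * c * u
            ≡⟨ cong (λ x → x + k * c ℤ.^ w * c * u) (trans (sym (*-assoc M (eval K c c) uu)) (cong (λ x → x * uu) (K-diagonal c))) ⟩
          k * c ℤ.^ w * c * uu + k * c ℤ.^ w * c * u
            ≡⟨ factor (k * c ℤ.^ w) c u uu ⟩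
          k * c ℤ.^ w * (c * u + c * uu)
            ≡⟨ cong (λ x → k * c ℤ.^ w * x) (θ-geo m n) ⟨
          k * c ℤ.^ w * (+ n * u)
            ≡⟨ swap (k * c ℤ.^ w) (+ n) u ⟩
          + n * (k * c ℤ.^ w * u) ∎
          where
          c = + suc m
          u = U m n
          uu = (U m *ₛ U m) n
          factor : ∀ (p c u v : ℤ) → p * c * v + p * c * u ≡ p * (c * u + c * v)
          factor = solve-∀
          swap : ∀ (p n u : ℤ) → p * (n * u) ≡ n * (p * u)
          swap = solve-∀

        X D′ E′ S : ℤ
        X  = sum< n (λ m → sum< m (λ i → eval K (+ suc i) (+ suc m)) * U m n)
        D′ = sum< n (λ m → eval K (+ suc m) (+ suc m) * (U m *ₛ U m) n)
        E′ = sum< n (λ m → k * (+ suc m) ℤ.^ w * + suc m * U m n)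
        S  = (s i *ₛ s j) n

        X-total : M * X + E′ ≡ β₁ * s e₁ n + β₂ * s e₂ n + β₃ * s e₃ n
        X-total = begin
          M * X + E′
            ≡⟨ cong (λ x → x + E′) (sum<-* n M (λ m → sum< m (λ i → eval K (+ suc i) (+ suc m)) * U m n)) ⟨
          sum< n (λ m → M * (sum< m (λ i → eval K (+ suc i) (+ suc m)) * U m n)) + E′
            ≡⟨ sum<-+ n (λ m → M * (sum< m (λ i → eval K (+ suc i) (+ suc m)) * U m n))
                        (λ m → k * (+ suc m) ℤ.^ w * + suc m * U m n) ⟨
          sum< n (λ m → M * (sum< m (λ i → eval K (+ suc i) (+ suc m)) * U m n) + k * (+ suc m) ℤ.^ w * + suc m * U m n)
            ≡⟨ sum<-cong n (λ m _ → total-term m) ⟩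
          sum< n (λ m → x m + (y m + z m))
            ≡⟨ trans (sum<-+ n x (λ m → y m + z m)) (cong-+ (sum< n x) (sum<-+ n y z)) ⟩
          sum< n x + (sum< n y + sum< n z)
            ≡⟨ cong₂ _+_ (sum<-*-geo β₁ e₁ n) (cong₂ _+_ (sum<-*-geo β₂ e₂ n) (sum<-*-geo β₃ e₃ n)) ⟩
          β₁ * s e₁ n + (β₂ * s e₂ n + β₃ * s e₃ n)
            ≡⟨ +-assoc (β₁ * s e₁ n) (β₂ * s e₂ n) (β₃ * s e₃ n) ⟨
          β₁ * s e₁ n + β₂ * s e₂ n + β₃ * s e₃ n ∎
          where
          x y z : ℕ → ℤ
          x m = β₁ * (+ suc m) ℤ.^ e₁ * U m n
          y m = β₂ * (+ suc m) ℤ.^ e₂ * U m n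
          z m = β₃ * (+ suc m) ℤ.^ e₃ * U m n

        diagonal-total : M * D′ + E′ ≡ k * (+ n * s w n)
        diagonal-total = begin
          M * D′ + E′
            ≡⟨ cong (λ x → x + E′) (sum<-* n M (λ m → eval K (+ suc m) (+ suc m) * (U m *ₛ U m) n)) ⟨
          sum< n (λ m → M * (eval K (+ suc m) (+ suc m) * (U m *ₛ U m) n)) + E′
            ≡⟨ sum<-+ n (λ m → M * (eval K (+ suc m) (+ suc m) * (U m *ₛ U m) n))
                        (λ m → k * (+ suc m) ℤ.^ w * + suc m * U m n) ⟨
          sum< n (λ m → M * (eval K (+ suc m) (+ suc m) * (U m *ₛ U m) n) + k * (+ suc m) ℤ.^ w * + suc m * U m n)
            ≡⟨ sum<-cong n (λ m _ → diagonal-term m) ⟩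
          sum< n (λ m → + n * (k * (+ suc m) ℤ.^ w * U m n))
            ≡⟨ sum<-* n (+ n) (λ m → k * (+ suc m) ℤ.^ w * U m n) ⟩
          + n * sum< n (λ m → k * (+ suc m) ℤ.^ w * U m n)
            ≡⟨ cong (λ x → + n * x) (sum<-*-geo k w n) ⟩
          + n * (k * s w n)
            ≡⟨ swap (+ n) k (s w n) ⟩
          k * (+ n * s w n) ∎
          where
          swap : ∀ (p n u : ℤ) → p * (n * u) ≡ n * (p * u)
          swap = solve-∀

        odd-total : M * T (λ a b → eval K a (a + b)) n ≡ M * T (eval K) n + κ * (S + S)
        odd-total = begin
          M * T (λ a b → eval K a (a + b)) n
            ≡⟨ T-* M (λ a b → eval K a (a + b)) n ⟨
          T (λ a b → M * eval K a (a + b)) n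
            ≡⟨ T-cong n K-odd ⟩
          T (λ a b → M * eval K a b + κ * (p a b + q a b)) n
            ≡⟨ T-+ (λ a b → M * eval K a b) (λ a b → κ * (p a b + q a b)) n ⟩
          T (λ a b → M * eval K a b) n + T (λ a b → κ * (p a b + q a b)) n
            ≡⟨ cong₂ _+_ (T-* M (eval K) n) (trans (T-* κ (λ a b → p a b + q a b) n) (cong (λ x → κ * x) (T-+ p q n))) ⟩
          M * T (eval K) n + κ * (T p n + T q n)
            ≡⟨ cong₂ (λ x y → M * T (eval K) n + κ * (x + y)) (T-monomial i j n)
                     (trans (T-monomial j i n) (*ₛ-comm (s j) (s i) n)) ⟩
          M * T (eval K) n + κ * (S + S) ∎
          where
          p q : ℤ → ℤ → ℤ
          p a b = a ℤ.^ i * b ℤ.^ j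
          q a b = a ℤ.^ j * b ℤ.^ i

      -- In M times `T-relation` the sum `T (eval K)` occurs on both sides, by `odd-total`, and
      -- drops out. What remains is 2 κ S + M D′ = M X, and adding E′ turns both remainders into
      -- divisor sums.
      convolution : + 2 * κ * (s i *ₛ s j) n + k * (+ n * s w n) ≡ β₁ * s e₁ n + β₂ * s e₂ n + β₃ * s e₃ n
      convolution = begin
        + 2 * κ * S + k * (+ n * s w n)
          ≡⟨ cong-+ (+ 2 * κ * S) diagonal-total ⟨
        + 2 * κ * S + (M * D′ + E′)
          ≡⟨ complete κ S (M * T (eval K) n) (M * D′) E′ ⟩
        M * T (eval K) n + κ * (S + S) + M * D′ + E′ - M * T (eval K) n
          ≡⟨ cong (λ x → x + M * D′ + E′ - M * T (eval K) n) odd-total ⟨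
        M * T (λ a b → eval K a (a + b)) n + M * D′ + E′ - M * T (eval K) n
          ≡⟨ cong (λ x → x + E′ - M * T (eval K) n) (*-distribˡ-+ M (T (λ a b → eval K a (a + b)) n) D′) ⟨
        M * (T (λ a b → eval K a (a + b)) n + D′) + E′ - M * T (eval K) n
          ≡⟨ cong (λ x → M * x + E′ - M * T (eval K) n) (T-relation (eval K) K-symmetric K-invariant n) ⟩
        M * (X + T (eval K) n) + E′ - M * T (eval K) n
          ≡⟨ cancel M X (T (eval K) n) E′ ⟩
        M * X + E′
          ≡⟨ X-total ⟩
        β₁ * s e₁ n + β₂ * s e₂ n + β₃ * s e₃ n ∎
        where
        complete : ∀ (κ S t d e : ℤ) → + 2 * κ * S + (d + e) ≡ t + κ * (S + S) + d + e + - t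
        complete = solve-∀
        cancel : ∀ (M x t e : ℤ) → M * (x + t) + e + - (M * t) ≡ M * x + e
        cancel = solve-∀

  -- Logarithmic derivatives and the Euler product.

  sum<-last : ∀ n (f : ℕ → ℤ) → sum< (suc n) f ≡ sum< n f + f n
  sum<-last zero    f = +-comm (f 0) 0ℤ
  sum<-last (suc n) f = trans (cong-+ (f 0) (sum<-last n (f ∘ suc))) (sym (+-assoc (f 0) (sum< n (f ∘ suc)) (f (suc n))))

  infix 4 _hasLogDerivative_
  -- The quotient θ f / f is multiplied out, so that no inverse series has to be formed.
  _hasLogDerivative_ : Series → Series → Set
  f hasLogDerivative v = θ f ≗ f *ₛ v

  1ₛ-logDerivative : 1ₛ hasLogDerivative (λ _ → 0ℤ)
  1ₛ-logDerivative n = trans (θ-q^ 0 n) (sym (q^-*ₛ 0 (λ _ → 0ℤ) n))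

  *ₛ-logDerivative : ∀ {f g v w} → f hasLogDerivative v → g hasLogDerivative w →
                     (f *ₛ g) hasLogDerivative (v +ₛ w)
  *ₛ-logDerivative {f} {g} {v} {w} θf θg n = begin
    θ (f *ₛ g) n                              ≡⟨ θ-*ₛ f g n ⟩
    (θ f *ₛ g) n + (f *ₛ θ g) n               ≡⟨ cong₂ _+_ (*ₛ-cong {g = g} θf (λ _ → refl) n) (*ₛ-cong {f} (λ _ → refl) θg n) ⟩
    ((f *ₛ v) *ₛ g) n + (f *ₛ (g *ₛ w)) n     ≡⟨ cong₂ _+_ swap (sym (*ₛ-assoc f g w n)) ⟩
    ((f *ₛ g) *ₛ v) n + ((f *ₛ g) *ₛ w) n     ≡⟨ *ₛ-distribˡ (f *ₛ g) v w n ⟨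
    ((f *ₛ g) *ₛ (v +ₛ w)) n                  ∎
    where
    swap : ((f *ₛ v) *ₛ g) n ≡ ((f *ₛ g) *ₛ v) n
    swap = begin
      ((f *ₛ v) *ₛ g) n   ≡⟨ *ₛ-assoc f v g n ⟩
      (f *ₛ (v *ₛ g)) n   ≡⟨ *ₛ-cong {f} (λ _ → refl) (*ₛ-comm v g) n ⟩
      (f *ₛ (g *ₛ v)) n   ≡⟨ *ₛ-assoc f g v n ⟨
      ((f *ₛ g) *ₛ v) n   ∎

  logDerivative-cong : ∀ {f v w} → f hasLogDerivative v → v ≗ w → f hasLogDerivative w
  logDerivative-cong {f} θf v≗w n = trans (θf n) (*ₛ-cong {f} (λ _ → refl) v≗w n)

  ^ₛ-logDerivative : ∀ {f v} → f hasLogDerivative v → ∀ e → (f ^ₛ e) hasLogDerivative (+ e ·ₛ v)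
  ^ₛ-logDerivative         θf zero    = 1ₛ-logDerivative
  ^ₛ-logDerivative {f} {v} θf (suc e) = logDerivative-cong
    {f ^ₛ suc e} (*ₛ-logDerivative {f ^ₛ e} {f} {+ e ·ₛ v} (^ₛ-logDerivative θf e) θf)
    (λ n → sym (suc-*′ (+ e) (v n)))
    where
    suc-*′ : ∀ (x y : ℤ) → (1ℤ + x) * y ≡ x * y + y
    suc-*′ = solve-∀

  ∏≤-logDerivative : ∀ {f : ℕ → Series} {v : ℕ → Series} → (∀ i → f (suc i) hasLogDerivative v i) →
                     ∀ N → ∏≤ f N hasLogDerivative (λ m → sum< N (λ i → v i m))
  ∏≤-logDerivative         θf zero    = 1ₛ-logDerivative
  ∏≤-logDerivative {f} {v} θf (suc N) = logDerivative-cong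
    {∏≤ f (suc N)} (*ₛ-logDerivative {∏≤ f N} {f (suc N)} {λ m → sum< N (λ i → v i m)} (∏≤-logDerivative θf N) (θf N))
    (λ m → sym (sum<-last N (λ i → v i m)))

  -- The left side is - k q ^ k, and `geo-unfold` rewrites q ^ k as (1 - q ^ k) U k.
  1-q^-logDerivative : ∀ i → let k = suc i in (1ₛ -ₛ q^ k) hasLogDerivative ((- + k) ·ₛ geo k)
  1-q^-logDerivative i n = begin
    + n * (1ₛ n - (q^ k) n)
      ≡⟨ distribute (+ n) (1ₛ n) ((q^ k) n) ⟩
    θ 1ₛ n - θ (q^ k) n
      ≡⟨ cong₂ _-_ (θ-q^ 0 n) (θ-q^ k n) ⟩
    0ℤ * 1ₛ n - + k * (q^ k) n
      ≡⟨ rearrange (+ k) (1ₛ n) ((q^ k) n) ((q^ k *ₛ u) n) ⟩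
    (- + k) * ((q^ k) n + (q^ k *ₛ u) n - (q^ k *ₛ u) n)
      ≡⟨ cong (λ x → (- + k) * (x - (q^ k *ₛ u) n)) (geo-unfold i n) ⟨
    (- + k) * (u n - (q^ k *ₛ u) n)
      ≡⟨ cong (λ x → (- + k) * x) (cong₂ _+_ (sym (q^-*ₛ 0 u n)) (sym negate)) ⟩
    (- + k) * ((1ₛ *ₛ u) n + ((- 1ℤ ·ₛ q^ k) *ₛ u) n)
      ≡⟨ cong (λ x → (- + k) * x) (*ₛ-distribʳ u 1ₛ (- 1ℤ ·ₛ q^ k) n) ⟨
    (- + k) * ((1ₛ +ₛ (- 1ℤ ·ₛ q^ k)) *ₛ u) n
      ≡⟨ cong (λ x → (- + k) * x) (*ₛ-cong {g = u} (λ m → cong-+ (1ₛ m) (-1*i≡-i ((q^ k) m))) (λ _ → refl) n) ⟩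
    (- + k) * ((1ₛ -ₛ q^ k) *ₛ u) n
      ≡⟨ *ₛ-·ₛ (- + k) (1ₛ -ₛ q^ k) u n ⟨
    ((1ₛ -ₛ q^ k) *ₛ ((- + k) ·ₛ u)) n ∎
    where
    k = suc i
    u = geo k
    negate : ((- 1ℤ ·ₛ q^ k) *ₛ u) n ≡ - (q^ k *ₛ u) n
    negate = trans (·ₛ-*ₛ (- 1ℤ) (q^ k) u n) (-1*i≡-i ((q^ k *ₛ u) n))
    distribute : ∀ (n x y : ℤ) → n * (x + - y) ≡ n * x + - (n * y)
    distribute = solve-∀
    rearrange : ∀ (k x y z : ℤ) → 0ℤ * x + - (k * y) ≡ (- k) * (y + z + - z)
    rearrange = solve-∀

  eulerProduct : ℕ → Series
  eulerProduct e = ∏∞ (λ k → (1ₛ -ₛ q^ k) ^ₛ e)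

  -- The coefficient of q ^ n sees only the n-th partial product, whose logarithmic derivative is -
  -- e times the sum of k U k over k ≤ n; up to q ^ n this agrees with - e `s 1`.
  eulerProduct-logDerivative : ∀ e → eulerProduct e hasLogDerivative ((- + e) ·ₛ s 1)
  eulerProduct-logDerivative e n = begin
    + n * ∏≤ f n n
      ≡⟨ ∏≤-logDerivative {f = f} {v = v} (λ i → ^ₛ-logDerivative (1-q^-logDerivative i) e) n n ⟩
    (∏≤ f n *ₛ (λ m → sum< n (λ i → v i m))) n
      ≡⟨ *ₛ-cong-≤ n (λ m m≤n → eulerProduct-converges e m≤n) divisors ⟩
    (eulerProduct e *ₛ ((- + e) ·ₛ s 1)) n ∎
    where
    f : ℕ → Series
    f k = (1ₛ -ₛ q^ k) ^ₛ e
    v : ℕ → Series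
    v i = + e ·ₛ ((- + suc i) ·ₛ geo (suc i))
    divisors : ∀ m → m ≤ n → sum< n (λ i → v i m) ≡ - + e * s 1 m
    divisors m m≤n = begin
      sum< n (λ i → v i m)
        ≡⟨ sum<-cong n (λ i _ → rearrange (+ e) (+ suc i) (geo (suc i) m)) ⟩
      sum< n (λ i → - + e * ((+ suc i) ℤ.^ 1 * geo (suc i) m))
        ≡⟨ sum<-* n (- + e) (λ i → (+ suc i) ℤ.^ 1 * geo (suc i) m) ⟩
      - + e * sum< n (λ i → (+ suc i) ℤ.^ 1 * geo (suc i) m)
        ≡⟨ cong (λ x → - + e * x) (s-geo 1 {m} m≤n) ⟨
      - + e * s 1 m ∎
      where
      rearrange : ∀ (c k x : ℤ) → c * ((- k) * x) ≡ - c * (k * 1ℤ * x)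
      rearrange = solve-∀

  -- The differential equation satisfied by τ.

  -- For c = - 24 this is θ f = E₂ f.
  IsSolution : ℤ → Series → Set
  IsSolution c f = θ f ≗ f +ₛ f *ₛ (c ·ₛ s 1)

  -- The factor q adds 1 to the logarithmic derivative, which is the constant term of E₂.
  q-eulerProduct-solution : ∀ e → IsSolution (- + e) (q^ 1 *ₛ eulerProduct e)
  q-eulerProduct-solution e n = begin
    θ (q^ 1 *ₛ f) n
      ≡⟨ θ-*ₛ (q^ 1) f n ⟩
    (θ (q^ 1) *ₛ f) n + (q^ 1 *ₛ θ f) n
      ≡⟨ cong₂ _+_ (*ₛ-cong {g = f} (λ m → trans (θ-q^ 1 m) (*-identityˡ ((q^ 1) m))) (λ _ → refl) n)
                   (*ₛ-cong {q^ 1} (λ _ → refl) (eulerProduct-logDerivative e) n) ⟩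
    Δ n + (q^ 1 *ₛ (f *ₛ ((- + e) ·ₛ s 1))) n
      ≡⟨ cong-+ (Δ n) (*ₛ-assoc (q^ 1) f ((- + e) ·ₛ s 1) n) ⟨
    Δ n + (Δ *ₛ ((- + e) ·ₛ s 1)) n ∎
    where
    f = eulerProduct e
    Δ = q^ 1 *ₛ f

  ·ₛ-solution : ∀ {a} c {f} → IsSolution a f → IsSolution a (c ·ₛ f)
  ·ₛ-solution {a} c {f} f-sol n = begin
    + n * (c * f n)                        ≡⟨ swap (+ n) c (f n) ⟩
    c * (+ n * f n)                        ≡⟨ cong (λ x → c * x) (f-sol n) ⟩
    c * (f n + (f *ₛ v) n)                 ≡⟨ *-distribˡ-+ c (f n) ((f *ₛ v) n) ⟩
    c * f n + c * (f *ₛ v) n               ≡⟨ cong-+ (c * f n) (·ₛ-*ₛ c f v n) ⟨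
    c * f n + ((c ·ₛ f) *ₛ v) n            ∎
    where
    v = a ·ₛ s 1
    swap : ∀ (n c x : ℤ) → n * (c * x) ≡ c * (n * x)
    swap = solve-∀

  -- As s 1 has no constant term, the equation determines (n - 1) f n from f 0, …, f (n - 1).
  solution-unique : ∀ {a f g} → IsSolution a f → IsSolution a g → f 0 ≡ g 0 → f 1 ≡ g 1 → f ≗ g
  solution-unique {a} {f} {g} f-sol g-sol f₀≡g₀ f₁≡g₁ n = below n n ℕ.≤-refl
    where
    v : Series
    v = a ·ₛ s 1
    step : ∀ {h} → IsSolution a h → ∀ m → + suc m * h (suc (suc m)) ≡ (h *ₛ (v ∘ suc)) (suc m)
    step {h} h-sol m = begin
      + suc m * x                                 ≡⟨ subtract (+ suc m) x ⟩
      (1ℤ + + suc m) * x - x                      ≡⟨ cong (λ y → y - x) (h-sol (suc (suc m))) ⟩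
      x + (h *ₛ v) (suc (suc m)) - x              ≡⟨ cong (λ y → x + y - x) (*ₛ-suc′ h v (suc m)) ⟩
      x + ((h *ₛ (v ∘ suc)) (suc m) + x * (a * 0ℤ)) - x ≡⟨ cancel a x ((h *ₛ (v ∘ suc)) (suc m)) ⟩
      (h *ₛ (v ∘ suc)) (suc m)                    ∎
      where
      x = h (suc (suc m))
      subtract : ∀ (m x : ℤ) → m * x ≡ (1ℤ + m) * x + - x
      subtract = solve-∀
      cancel : ∀ (a x y : ℤ) → x + (y + x * (a * 0ℤ)) + - x ≡ y
      cancel = solve-∀
    next : ∀ n → (∀ m → m ≤ n → f m ≡ g m) → f (suc n) ≡ g (suc n)
    -- At index 1 the factor n - 1 is zero, so the equation is silent there and the initial value
    -- decides.
    next zero    IH = f₁≡g₁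
    next (suc n) IH = *-cancelˡ-≡ (+ suc n) (f (suc (suc n))) (g (suc (suc n))) (begin
      + suc n * f (suc (suc n))      ≡⟨ step {f} f-sol n ⟩
      (f *ₛ (v ∘ suc)) (suc n)       ≡⟨ *ₛ-cong-≤ {g = v ∘ suc} (suc n) IH (λ _ _ → refl) ⟩
      (g *ₛ (v ∘ suc)) (suc n)       ≡⟨ step {g} g-sol n ⟨
      + suc n * g (suc (suc n))      ∎)
    below : ∀ n m → m ≤ n → f m ≡ g m
    below zero    zero z≤n = f₀≡g₀
    below (suc n) m    m≤1+n with m ℕ.≟ suc n
    ... | yes refl = next n (below n)
    ... | no  m≢1+n = below n m (ℕ.≤-pred (ℕ.≤∧≢⇒< m≤1+n m≢1+n))

  τ-solution : IsSolution (- + 24) τ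
  τ-solution = q-eulerProduct-solution 24

  -- The combination E₁₂ - E₆².

  θ-square : ∀ f → θ (f *ₛ f) ≗ + 2 ·ₛ (θ f *ₛ f)
  θ-square f n = begin
    θ (f *ₛ f) n                   ≡⟨ θ-*ₛ f f n ⟩
    (θ f *ₛ f) n + (f *ₛ θ f) n    ≡⟨ cong-+ ((θ f *ₛ f) n) (*ₛ-comm f (θ f) n) ⟩
    x + x                          ≡⟨ double x ⟩
    + 2 * x                        ∎
    where
    x = (θ f *ₛ f) n
    double : ∀ (x : ℤ) → x + x ≡ + 2 * x
    double = solve-∀

  -- The equalities let the numerals take the form that cusp-solution expects. Leaving this to conversion would
  -- unfold products with large literals in unary.
  convolution-with : (certificate : Certificate) → let open Certificate certificate in
    ∀ i′ j′ w′ e₁′ e₂′ e₃′ {κ′ k′ β₁′ β₂′ β₃′} →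
    i ≡ i′ → j ≡ j′ → w ≡ w′ → e₁ ≡ e₁′ → e₂ ≡ e₂′ → e₃ ≡ e₃′ →
    + 2 * κ ≡ κ′ → k ≡ k′ → β₁ ≡ β₁′ → β₂ ≡ β₂′ → β₃ ≡ β₃′ →
    ∀ n → κ′ * (s i′ *ₛ s j′) n + k′ * (+ n * s w′ n) ≡ β₁′ * s e₁′ n + β₂′ * s e₂′ n + β₃′ * s e₃′ n
  convolution-with certificate _ _ _ _ _ _ refl refl refl refl refl refl refl refl refl refl refl =
    convolution certificate

  -- With the coefficients 65, 691 and - 252 · 691 this is 691 / 1008 times E₁₂ - E₆².
  cusp : ℤ → ℤ → ℤ → Series
  cusp a b c = a ·ₛ s 11 +ₛ b ·ₛ s 5 +ₛ c ·ₛ (s 5 *ₛ s 5)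

  -- For a = 65, b = 691, u = 42, y = 6 and z = 20 the convolutions are those of the three certificates.
  module _ (a b u y z : ℤ)
    (convolution₁ : ∀ n → + 4 * y * u * (s 1 *ₛ s 5) n + + 2 * u * (+ n * s 5 n) ≡
                          + 2 * s 1 n + u * s 5 n + + 2 * z * s 7 n)
    (convolution₂ : ∀ n → + 4 * y * z * u * (s 5 *ₛ s 7) n + 0ℤ * (+ n * s 11 n) ≡
                          - u * s 5 n + + 2 * z * s 7 n + + 2 * s 13 n)
    (convolution₃ : ∀ n → + 8 * y * u * a * (s 1 *ₛ s 11) n + + 2 * u * a * (+ n * s 11 n) ≡
                          - (+ 2 * b) * s 1 n + + 2 * u * a * s 11 n + + 2 * b * s 13 n) where

    -- The derivative of E₆² is 2 E₆ θ E₆. As E₆ is 1 plus a multiple of `s 5`, the first identity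
    -- is needed both as it stands and multiplied by `s 5`.
    convolution₁-s5 : ∀ n → + 4 * y * u * (s 1 *ₛ (s 5 *ₛ s 5)) n + + 2 * u * (θ (s 5) *ₛ s 5) n ≡
                             + 2 * (s 1 *ₛ s 5) n + u * (s 5 *ₛ s 5) n + + 2 * z * (s 5 *ₛ s 7) n
    convolution₁-s5 n = begin
      + 4 * y * u * (s 1 *ₛ (s 5 *ₛ s 5)) n + + 2 * u * (θ (s 5) *ₛ s 5) n
        ≡⟨ cong (λ x → + 4 * y * u * x + + 2 * u * (θ (s 5) *ₛ s 5) n) (*ₛ-assoc (s 1) (s 5) (s 5) n) ⟨
      + 4 * y * u * ((s 1 *ₛ s 5) *ₛ s 5) n + + 2 * u * (θ (s 5) *ₛ s 5) n
        ≡⟨ linear₂ (+ 4 * y * u) (s 1 *ₛ s 5) (+ 2 * u) (θ (s 5)) ⟨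
      (((+ 4 * y * u) ·ₛ (s 1 *ₛ s 5) +ₛ (+ 2 * u) ·ₛ θ (s 5)) *ₛ s 5) n
        ≡⟨ *ₛ-cong {g = s 5} convolution₁ (λ _ → refl) n ⟩
      (((+ 2 ·ₛ s 1 +ₛ u ·ₛ s 5) +ₛ (+ 2 * z) ·ₛ s 7) *ₛ s 5) n
        ≡⟨ trans (*ₛ-distribʳ (s 5) (+ 2 ·ₛ s 1 +ₛ u ·ₛ s 5) ((+ 2 * z) ·ₛ s 7) n)
                 (cong₂ _+_ (linear₂ (+ 2) (s 1) u (s 5)) (·ₛ-*ₛ (+ 2 * z) (s 7) (s 5) n)) ⟩
      + 2 * (s 1 *ₛ s 5) n + u * (s 5 *ₛ s 5) n + + 2 * z * (s 7 *ₛ s 5) n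
        ≡⟨ cong (λ x → + 2 * (s 1 *ₛ s 5) n + u * (s 5 *ₛ s 5) n + + 2 * z * x) (*ₛ-comm (s 7) (s 5) n) ⟩
      + 2 * (s 1 *ₛ s 5) n + u * (s 5 *ₛ s 5) n + + 2 * z * (s 5 *ₛ s 7) n ∎
      where
      linear₂ : ∀ a f b g → ((a ·ₛ f +ₛ b ·ₛ g) *ₛ s 5) n ≡ a * (f *ₛ s 5) n + b * (g *ₛ s 5) n
      linear₂ a f b g = trans (*ₛ-distribʳ (s 5) (a ·ₛ f) (b ·ₛ g) n)
                              (cong₂ _+_ (·ₛ-*ₛ a f (s 5) n) (·ₛ-*ₛ b g (s 5) n))

    private
      f : Series
      f = cusp a b (- (y * u * b))

    cusp-*ₛ-s1 : ∀ n → (f *ₛ ((- (+ 4 * y)) ·ₛ s 1)) n ≡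
      - (+ 4 * y) * (a * (s 1 *ₛ s 11) n + b * (s 1 *ₛ s 5) n + - (y * u * b) * (s 1 *ₛ (s 5 *ₛ s 5)) n)
    cusp-*ₛ-s1 n = begin
      (f *ₛ ((- (+ 4 * y)) ·ₛ s 1)) n
        ≡⟨ *ₛ-·ₛ (- (+ 4 * y)) f (s 1) n ⟩
      - (+ 4 * y) * (f *ₛ s 1) n
        ≡⟨ cong (λ x → - (+ 4 * y) * x) (trans (*ₛ-comm f (s 1) n) (trans
             (*ₛ-distribˡ (s 1) (a ·ₛ s 11 +ₛ b ·ₛ s 5) ((- (y * u * b)) ·ₛ (s 5 *ₛ s 5)) n)
             (cong₂ _+_ (trans (*ₛ-distribˡ (s 1) (a ·ₛ s 11) (b ·ₛ s 5) n)
                               (cong₂ _+_ (*ₛ-·ₛ a (s 1) (s 11) n) (*ₛ-·ₛ b (s 1) (s 5) n)))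
                        (*ₛ-·ₛ (- (y * u * b)) (s 1) (s 5 *ₛ s 5) n)))) ⟩
      - (+ 4 * y) * (a * (s 1 *ₛ s 11) n + b * (s 1 *ₛ s 5) n + - (y * u * b) * (s 1 *ₛ (s 5 *ₛ s 5)) n) ∎

    cusp-solution : .{{_ : ℤ.NonZero u}} → IsSolution (- (+ 4 * y)) (cusp a b (- (y * u * b)))
    -- The convolutions carry their derivatives with the factor 2 u, so the equation is proved 2
    -- u-fold and then cancelled.
    cusp-solution n = *-cancelˡ-≡ u (θ f n) ((f +ₛ f *ₛ ((- (+ 4 * y)) ·ₛ s 1)) n)
      (*-cancelˡ-≡ (+ 2) (u * θ f n) (u * (f +ₛ f *ₛ ((- (+ 4 * y)) ·ₛ s 1)) n) (begin
      + 2 * (u * (+ n * (a * x₁₁ + b * x₅ + - (y * u * b) * p)))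
        ≡⟨ expand a b u y (+ n) x₁₁ x₅ p ⟩
      + 2 * u * a * t₁₁ + + 2 * u * b * t₅ + - (+ 2 * u * y * u * b) * (+ n * p)
        ≡⟨ cong (λ x → + 2 * u * a * t₁₁ + + 2 * u * b * t₅ + - (+ 2 * u * y * u * b) * x) (θ-square (s 5) n) ⟩
      + 2 * u * a * t₁₁ + + 2 * u * b * t₅ + - (+ 2 * u * y * u * b) * (+ 2 * w)
        ≡⟨ combine a b u y z t₁₁ t₅ w c₁₁ c₅ c₇ r ⟩
      (+ 8 * y * u * a * c₁₁ + + 2 * u * a * t₁₁) + b * (+ 4 * y * u * c₅ + + 2 * u * t₅)
        + - (+ 2 * y * u * b) * (+ 4 * y * u * r + + 2 * u * w)
        + - b * (+ 4 * y * z * u * c₇ + 0ℤ * t₁₁)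
        + rest
        ≡⟨ cong (λ x → x + rest) (cong₂ _+_ (cong₂ _+_ (cong₂ (λ x x′ → x + b * x′) (convolution₃ n) (convolution₁ n))
             (cong (λ x → - (+ 2 * y * u * b) * x) (convolution₁-s5 n))) (cong (λ x → - b * x) (convolution₂ n))) ⟩
      (- (+ 2 * b) * x₁ + + 2 * u * a * x₁₁ + + 2 * b * x₁₃) + b * (+ 2 * x₁ + u * x₅ + + 2 * z * x₇)
        + - (+ 2 * y * u * b) * (+ 2 * c₅ + u * p + + 2 * z * c₇)
        + - b * (- u * x₅ + + 2 * z * x₇ + + 2 * x₁₃)
        + rest
        ≡⟨ collect a b u y z x₁ x₅ x₇ x₁₁ x₁₃ p c₅ c₇ c₁₁ r ⟩
      + 2 * (u * (f n + - (+ 4 * y) * (a * c₁₁ + b * c₅ + - (y * u * b) * r)))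
        ≡⟨ cong (λ x → + 2 * (u * (f n + x))) (cusp-*ₛ-s1 n) ⟨
      + 2 * (u * (f n + (f *ₛ ((- (+ 4 * y)) ·ₛ s 1)) n)) ∎))
      where
      p   = (s 5 *ₛ s 5) n
      w   = (θ (s 5) *ₛ s 5) n
      c₅  = (s 1 *ₛ s 5) n
      c₇  = (s 5 *ₛ s 7) n
      c₁₁ = (s 1 *ₛ s 11) n
      r   = (s 1 *ₛ (s 5 *ₛ s 5)) n
      x₁  = s 1 n
      x₅  = s 5 n
      x₇  = s 7 n
      x₁₁ = s 11 n
      x₁₃ = s 13 n
      t₅  = + n * x₅
      t₁₁ = + n * x₁₁
      -- Before the substitution `rest` cancels the products of series in the four left sides.
      -- Afterwards it completes the product of f with - 4 y `s 1`, and its `c₇` term removes what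
      -- is left of E₆ E₈.
      rest = - (+ 8 * y * u * a) * c₁₁ + - (+ 4 * y * u * b) * c₅ + + 8 * y * u * y * u * b * r + + 4 * y * z * u * b * c₇
      expand : ∀ (a b u y n x₁₁ x₅ p : ℤ) → + 2 * (u * (n * (a * x₁₁ + b * x₅ + - (y * u * b) * p))) ≡
        + 2 * u * a * (n * x₁₁) + + 2 * u * b * (n * x₅) + - (+ 2 * u * y * u * b) * (n * p)
      expand = solve-∀
      combine : ∀ (a b u y z t₁₁ t₅ w c₁₁ c₅ c₇ r : ℤ) →
        + 2 * u * a * t₁₁ + + 2 * u * b * t₅ + - (+ 2 * u * y * u * b) * (+ 2 * w) ≡
        (+ 8 * y * u * a * c₁₁ + + 2 * u * a * t₁₁) + b * (+ 4 * y * u * c₅ + + 2 * u * t₅)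
        + - (+ 2 * y * u * b) * (+ 4 * y * u * r + + 2 * u * w)
        + - b * (+ 4 * y * z * u * c₇ + 0ℤ * t₁₁)
        + (- (+ 8 * y * u * a) * c₁₁ + - (+ 4 * y * u * b) * c₅ + + 8 * y * u * y * u * b * r + + 4 * y * z * u * b * c₇)
      combine = solve-∀
      collect : ∀ (a b u y z x₁ x₅ x₇ x₁₁ x₁₃ p c₅ c₇ c₁₁ r : ℤ) →
        (- (+ 2 * b) * x₁ + + 2 * u * a * x₁₁ + + 2 * b * x₁₃) + b * (+ 2 * x₁ + u * x₅ + + 2 * z * x₇)
        + - (+ 2 * y * u * b) * (+ 2 * c₅ + u * p + + 2 * z * c₇)
        + - b * (- u * x₅ + + 2 * z * x₇ + + 2 * x₁₃)
        + (- (+ 8 * y * u * a) * c₁₁ + - (+ 4 * y * u * b) * c₅ + + 8 * y * u * y * u * b * r + + 4 * y * z * u * b * c₇) ≡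
        + 2 * (u * ((a * x₁₁ + b * x₅ + - (y * u * b) * p) + - (+ 4 * y) * (a * c₁₁ + b * c₅ + - (y * u * b) * r)))
      collect = solve-∀

  -- Comparison with τ and the rational formula.

  sum-applyUpTo : ∀ (f g : ℕ → ℕ) n → + sum (map f (applyUpTo g n)) ≡ sum< n (λ i → + f (g i))
  sum-applyUpTo f g zero    = refl
  sum-applyUpTo f g (suc n) = trans (pos-+ (f (g 0)) (sum (map f (applyUpTo (g ∘ suc) n))))
                                    (cong-+ (+ f (g 0)) (sum-applyUpTo f (g ∘ suc) n))

  -- The convolution has two terms more than the list: index 0, killed by θ, and the last index,
  -- where the other factor is σ l 0 = 0.
  θs-*ₛ-s : ∀ k l n → + sum (map (λ m → m ℕ.* σ k m ℕ.* σ l (suc n ∸ m)) (applyUpTo suc n)) ≡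
                      (θ (s k) *ₛ s l) (suc n)
  θs-*ₛ-s k l n = begin
    + sum (map (λ m → m ℕ.* σ k m ℕ.* σ l (suc n ∸ m)) (applyUpTo suc n))
      ≡⟨ sum-applyUpTo (λ m → m ℕ.* σ k m ℕ.* σ l (suc n ∸ m)) suc n ⟩
    sum< n (λ i → + (suc i ℕ.* σ k (suc i) ℕ.* σ l (n ∸ i)))
      ≡⟨ sum<-cong n (λ i _ → trans (pos-* (suc i ℕ.* σ k (suc i)) (σ l (n ∸ i)))
           (cong (λ x → x * s l (n ∸ i)) (pos-* (suc i) (σ k (suc i))))) ⟩
    sum< n term
      ≡⟨ trans (cong-+ (sum< n term) last≡0) (+-identityʳ (sum< n term)) ⟨
    sum< n term + term n
      ≡⟨ sum<-last n term ⟨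
    sum< (suc n) term
      ≡⟨ +-identityˡ (sum< (suc n) term) ⟨
    (θ (s k) *ₛ s l) (suc n) ∎
    where
    term : ℕ → ℤ
    term i = θ (s k) (suc i) * s l (n ∸ i)
    last≡0 : term n ≡ 0ℤ
    last≡0 = trans (cong (λ m → θ (s k) (suc n) * s l m) (ℕ.n∸n≡0 n)) (*-zeroʳ (θ (s k) (suc n)))

  cusp₁₂-solution : IsSolution (- (+ 4 * + 6)) (cusp (+ 65) (+ 691) (- (+ 6 * + 42 * + 691)))
  cusp₁₂-solution = cusp-solution (+ 65) (+ 691) (+ 42) (+ 6) (+ 20)
    (convolution-with certificate₁ 1 5 5 1 5 7 {+ 4 * + 6 * + 42} {+ 2 * + 42} {+ 2} {+ 42} {+ 2 * + 20}
      refl refl refl refl refl refl refl refl refl refl refl)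
    (convolution-with certificate₂ 5 7 11 5 7 13 {+ 4 * + 6 * + 20 * + 42} {0ℤ} { - + 42} {+ 2 * + 20} {+ 2}
      refl refl refl refl refl refl refl refl refl refl refl)
    (convolution-with certificate₃ 1 11 11 1 11 13
      {+ 8 * + 6 * + 42 * + 65} {+ 2 * + 42 * + 65} { - (+ 2 * + 691)} {+ 2 * + 42 * + 65} {+ 2 * + 691}
      refl refl refl refl refl refl refl refl refl refl refl)

  756τ-solution : IsSolution (- (+ 4 * + 6)) (+ 756 ·ₛ τ)
  756τ-solution = ·ₛ-solution { - (+ 4 * + 6)} (+ 756) {τ} (subst (λ a → IsSolution a τ) -24≡ τ-solution)
    where
    -24≡ : - + 24 ≡ - (+ 4 * + 6)
    -24≡ = refl

  cusp₁₂≗756τ : cusp (+ 65) (+ 691) (- (+ 6 * + 42 * + 691)) ≗ (+ 756 ·ₛ τ)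
  cusp₁₂≗756τ = solution-unique
    { - (+ 4 * + 6)} {cusp (+ 65) (+ 691) (- (+ 6 * + 42 * + 691))} {+ 756 ·ₛ τ}
    -- Both constant terms are 0. The coefficients of q are 65 + 691 and 756 · τ(1), which fixes the
    -- factor 756.
    cusp₁₂-solution 756τ-solution refl refl

  -- Here y u = 252, a third of 756, so the coefficient y u b of the square becomes b / 3 after
  -- division by D; the relation n p = 2 w then yields 2 b / (3 n). The equations for D, c and N
  -- keep the numerals out of the ring identities.
  clear-denominators : ∀ {t a x b x₅ y u p w n D c N : ℤ} →
    a * x + b * x₅ + - (y * u * b) * p ≡ D * t → n * p ≡ + 2 * w →
    D ≡ + 3 * (y * u) → c ≡ + 2 * b → N ≡ + 3 * n →
    t * D * N ≡ (a * x + b * x₅) * N - c * w * D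
  clear-denominators {t} {a} {x} {b} {x₅} {y} {u} {p} {w} {n} eq np refl refl refl = begin
    t * (+ 3 * (y * u)) * (+ 3 * n)
      ≡⟨ commute t (+ 3 * (y * u)) (+ 3 * n) ⟩
    + 3 * (y * u) * t * (+ 3 * n)
      ≡⟨ cong (λ z → z * (+ 3 * n)) eq ⟨
    (a * x + b * x₅ + - (y * u * b) * p) * (+ 3 * n)
      ≡⟨ expand (a * x + b * x₅) y u b p n ⟩
    (a * x + b * x₅) * (+ 3 * n) + - (+ 3 * y * u * b) * (n * p)
      ≡⟨ cong (λ z → (a * x + b * x₅) * (+ 3 * n) + - (+ 3 * y * u * b) * z) np ⟩
    (a * x + b * x₅) * (+ 3 * n) + - (+ 3 * y * u * b) * (+ 2 * w)
      ≡⟨ collect ((a * x + b * x₅) * (+ 3 * n)) y u b w ⟩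
    (a * x + b * x₅) * (+ 3 * n) - + 2 * b * w * (+ 3 * (y * u)) ∎
    where
    commute : ∀ (t d e : ℤ) → t * d * e ≡ d * t * e
    commute = solve-∀
    expand : ∀ (z y u b p n : ℤ) → (z + - (y * u * b) * p) * (+ 3 * n) ≡ z * (+ 3 * n) + - (+ 3 * y * u * b) * (n * p)
    expand = solve-∀
    collect : ∀ (z y u b w : ℤ) → z + - (+ 3 * y * u * b) * (+ 2 * w) ≡ z + - (+ 2 * b * w * (+ 3 * (y * u)))
    collect = solve-∀

  τ-formula : ∀ m → let n = suc m in
    τ n ℚ./ 1 ≡ (+ 65 ℚ./ 756) ℚ.* (s 11 n ℚ./ 1) ℚ.+ (+ 691 ℚ./ 756) ℚ.* (s 5 n ℚ./ 1)
      ℚ.- (ℚ._/_ (+ (2 ℕ.* 691)) (3 ℕ.* n) {{ ℕ.m*n≢0 3 n }})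
        ℚ.* (+ sum (map (λ l → l ℕ.* σ 5 l ℕ.* σ 5 (n ∸ l)) (applyUpTo suc m)) ℚ./ 1)
  -- 755 and `m ℕ.+ 2 ℕ.* n` are the predecessors of the denominators 756 and 3 n.
  τ-formula m = Fractions./-sum (τ n) (+ 65) (s 11 n) (+ 691) (s 5 n) (+ (2 ℕ.* 691)) w 755 (m ℕ.+ 2 ℕ.* n)
    (clear-denominators {τ n} {+ 65} {s 11 n} {+ 691} {s 5 n} {+ 6} {+ 42} {(s 5 *ₛ s 5) n} {w} {+ n} {+ 756}
      (cusp₁₂≗756τ n)
      (trans (θ-square (s 5) n) (cong (λ x → + 2 * x) (sym (θs-*ₛ-s 5 5 m))))
      refl refl (pos-* 3 n))
    where
    n = suc m
    w = + sum (map (λ l → l ℕ.* σ 5 l ℕ.* σ 5 (n ∸ l)) (applyUpTo suc m))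

open import Data.Rational using (ℚ; _/_; _+_; _-_; _*_)

theorem2p3 : (n : ℕ) → .{{ _ : NonZero n }} →
    τ n / 1 ≡
    (+ 65 / 756) * (+ σ 11 n / 1)
    + (+ 691 / 756) * (+ σ 5 n / 1)
    - (_/_ (+ (2 ℕ.* 691)) (3 ℕ.* n) {{ m*n≢0 3 n }})
    * (+ sum (map (λ m → m ℕ.* σ 5 m ℕ.* σ 5 (n ∸ m)) (applyUpTo suc (n ∸ 1))) / 1)
theorem2p3 (suc m) = Eisenstein.τ-formula m
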